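{- Let $\mathcal{P}$ be the set of integer partitions satisfying all of the following: (i) no part repeats; (ii) adjacent parts do not differ by $1$ if the smaller of the two is even; (iii) for every integer $j$, none of $(2j)+(2j+2)+(2j+4)$, $(2j+1)+(2j+2)+(2j+4)$, $(2j+1)+(2j+3)+(2j+4)$ occurs as a sub-partition. Let $\mathcal{P}'$ be the set of $\pi\in\mathcal{P}$ all of whose parts are at least $3$. Then, as formal power series in $x,q$, writing $N=i+2j+3k$, $$\sum_{\pi\in\mathcal{P}}x^{\ell(\pi)}q^{|\pi|}=\sum_{i,j,k\ge 0}(-1)^k\frac{x^{N}q^{N(N-1)+i+j+3k^2+3k}}{(q;q)_i\,(q^4;q^4)_j\,(q^6;q^6)_k},$$ $$\sum_{\pi\in\mathcal{P}'}x^{\ell(\pi)}q^{|\pi|}=\sum_{i,j,k\ge 0}(-1)^k\frac{x^{N}q^{N(N-1)+3i+5j+3k^2+9k}}{(q;q)_i\,(q^4;q^4)_j\,(q^6;q^6)_k}.$$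
   Context: Partitions are finite weakly increasing sequences of positive integers (the empty partition is included); $\ell(\pi)$ is the number of parts and $|\pi|$ the sum of the parts of $\pi$. A sub-partition of a partition is a contiguous portion of it. For $n\ge 0$, $(a;q)_n=\prod_{0\le t<n}(1-aq^t)$. All identities are identities of formal power series. -}

module Defs where

open import Data.Bool.Base using (if_then_else_)
open import Data.Integer.Base as ℤ using (ℤ; +_; 0ℤ; 1ℤ; -1ℤ)
open import Data.List.Base using (List; []; _∷_; length; foldr; map)
open import Data.List.Relation.Binary.Infix.Heterogeneous using (Infix)
open import Data.List.Relation.Binary.Subset.Propositional using (_⊆_)
open import Data.List.Relation.Unary.All using (All)
open import Data.List.Relation.Unary.Linked using (Linked)
open import Data.List.Relation.Unary.Unique.Propositional using (Unique)
open import Data.Nat.Base using (ℕ; zero; suc; _+_; _*_; _∸_; _≤_)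
open import Data.Nat.Divisibility using (_∣_)
open import Data.Nat.ListAction using (sum)
open import Data.Nat.Properties using (_≟_)
open import Data.Product.Base using (_×_; _,_; ∃)
open import Relation.Binary.PropositionalEquality using (_≡_)
open import Relation.Nullary.Decidable.Core using (does)
open import Relation.Nullary.Negation.Core using (¬_)

IsPartition : List ℕ → Set
IsPartition π = All (1 ≤_) π × Linked _≤_ π

-- Patterns have integer entries, since the index j below ranges over ℤ.
_occursIn_ : List ℤ → List ℕ → Set
_occursIn_ = Infix (λ z p → z ≡ + p)

record 𝒫 (π : List ℕ) : Set where
  field
    isPartition : IsPartition π
    noRepeats   : Unique π
    -- π is weakly increasing, so a is the smaller of the adjacent parts a, b.
    noEvenStep  : Linked (λ a b → ¬ (2 ∣ a × b ≡ a + 1)) π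
    avoids₁     : ∀ (j : ℤ) → let 2j = + 2 ℤ.* j in
                  ¬ ((2j ∷ 2j ℤ.+ + 2 ∷ 2j ℤ.+ + 4 ∷ []) occursIn π)
    avoids₂     : ∀ (j : ℤ) → let 2j = + 2 ℤ.* j in
                  ¬ ((2j ℤ.+ + 1 ∷ 2j ℤ.+ + 2 ∷ 2j ℤ.+ + 4 ∷ []) occursIn π)
    avoids₃     : ∀ (j : ℤ) → let 2j = + 2 ℤ.* j in
                  ¬ ((2j ℤ.+ + 1 ∷ 2j ℤ.+ + 3 ∷ 2j ℤ.+ + 4 ∷ []) occursIn π)

𝒫′ : List ℕ → Set
𝒫′ π = 𝒫 π × All (3 ≤_) π

-- ℤ[[q]]: f n is the coefficient of qⁿ.
QSeries : Set
QSeries = ℕ → ℤ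

∑< : ℕ → (ℕ → ℤ) → ℤ
∑< zero    f = 0ℤ
∑< (suc n) f = ∑< n f ℤ.+ f n

infix  9 q^_
infixr 8 _^q_
infixl 7 _*q_ _/q_
infixl 6 _-q_

0q 1q : QSeries
0q _ = 0ℤ

q^_ : ℕ → QSeries
(q^ e) n = if does (n ≟ e) then 1ℤ else 0ℤ

1q = q^ 0

_-q_ _*q_ : QSeries → QSeries → QSeries
(f -q g) n = f n ℤ.- g n
(f *q g) n = ∑< (suc n) (λ k → f k ℤ.* g (n ∸ k))

_^q_ : QSeries → ℕ → QSeries
f ^q zero  = 1q
f ^q suc n = f ^q n *q f

-- The multiplicative inverse of a series f with constant term 1, namely
-- ∑_{r ≥ 0} (1 - f)ʳ; the terms with r > n do not contribute to qⁿ.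
-- Meaningless for other f.
invq : QSeries → QSeries
invq f n = ∑< (suc n) (λ r → ((1q -q f) ^q r) n)

_/q_ : QSeries → QSeries → QSeries
f /q g = f *q invq g

-- poch a b n = (a; b)ₙ
poch : QSeries → QSeries → ℕ → QSeries
poch a b zero    = 1q
poch a b (suc n) = poch a b n *q (1q -q a *q b ^q n)

-- ℤ[[x,q]] = ℤ[[q]][[x]]: F m n is the coefficient of xᵐ qⁿ.
XQSeries : Set
XQSeries = ℕ → QSeries

_·x^_ : QSeries → ℕ → XQSeries
(c ·x^ e) m = if does (m ≟ e) then c else 0q

∑coeff : {I : Set} → (I → XQSeries) → List I → ℕ → ℕ → ℤ
∑coeff f L m n = foldr ℤ._+_ 0ℤ (map (λ i → f i m n) L)

-- S = ∑_{i ∈ P} f i, unconditionally, in the topology of coefficientwise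
-- stabilisation: each coefficient of a finite partial sum equals that of S as
-- soon as the partial sum includes a certain finite set of indices.
-- Duplicate-free lists serve as finite sets of indices.
HasSum : {I : Set} → (I → Set) → (I → XQSeries) → XQSeries → Set
HasSum {I} P f S =
  ∀ m n → ∃ λ (L : List I) → Unique L × All P L ×
    (∀ (L′ : List I) → Unique L′ → All P L′ → L ⊆ L′ → ∑coeff f L′ m n ≡ S m n)

weight : List ℕ → XQSeries
weight π = (q^ sum π) ·x^ length π

sign : ℕ → QSeries
sign k n = if does (n ≟ 0) then -1ℤ ℤ.^ k else 0ℤ

denominator : ℕ → ℕ → ℕ → QSeries
denominator i j k =
  poch (q^ 1) (q^ 1) i *q poch (q^ 4) (q^ 4) j *q poch (q^ 6) (q^ 6) k

term term′ : ℕ × ℕ × ℕ → XQSeries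
term (i , j , k) =
  let N = i + 2 * j + 3 * k in
  (sign k *q q^ (N * (N ∸ 1) + i + j + 3 * (k * k) + 3 * k) /q denominator i j k) ·x^ N
term′ (i , j , k) =
  let N = i + 2 * j + 3 * k in
  (sign k *q q^ (N * (N ∸ 1) + 3 * i + 5 * j + 3 * (k * k) + 9 * k) /q denominator i j k) ·x^ N

{-# OPTIONS --safe #-}
-- Cutting the parts into blocks {2j+1, 2j+2} turns the conditions defining 𝒫
-- into a transfer rule between consecutive blocks, so that the generating
-- function F(x) = ∑_{π ∈ 𝒫} x^ℓ(π) q^|π| satisfies
--   F(x) = (1 + xq) F(xq²) + xq² (1 + xq) F(xq⁴) + x²q⁶ (1 - xq²) F(xq⁶).
-- On the other side, ∑ (-1)ᵏ x^N q^(i+j+3k²+3k) / ((q;q)ᵢ (q⁴;q⁴)ⱼ (q⁶;q⁶)ₖ)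
-- is the product P = A B D of a series in x, a series in x² and a series in x³,
-- and, 1 - x³q⁶ being divisible by 1 - xq²,
--   (1 - xq) (1 - x²q) P(x) = (1 + xq² + x²q⁴) P(xq²).
-- Multiplying the coefficient of x^N by q^(N(N-1)) turns this into the equation
-- for F, whose solution with constant term 1 in x is unique.  The second
-- identity is the first one with x replaced by xq².
module Submission where

open import Algebra.Bundles using (CommutativeRing)
import Algebra.Properties.CommutativeSemiring.Exp as CExp
import Algebra.Properties.Group as GroupProperties
import Algebra.Properties.Semiring.Exp as Exp
import Algebra.Solver.Ring.NaturalCoefficients.Default as Solver
open import Algebra.Structures using (IsCommutativeRing)
open import Data.Bool.Base using (true; false)
open import Data.Integer.Base as ℤ using (ℤ; +_; 0ℤ; 1ℤ; -1ℤ)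
import Data.Integer.Properties as ℤ
open import Data.List.Base
  using (List; []; _∷_; [_]; _++_; foldr; map; length; applyUpTo; upTo; cartesianProduct)
open import Data.List.Membership.Propositional using (_∈_; _∉_)
open import Data.List.Membership.Propositional.Properties
  using (∈-∃++; ∈-++⁺ˡ; ∈-++⁺ʳ; ∈-map⁺; ∈-cartesianProduct⁺; ∈-upTo⁺)
open import Data.List.Properties using (∷-injectiveʳ)
open import Data.List.Relation.Binary.Disjoint.Propositional using (Disjoint)
open import Data.List.Relation.Binary.Infix.Heterogeneous using (here; there)
open import Data.List.Relation.Binary.Permutation.Propositional using (↭-sym; ↭⇒↭ₛ)
import Data.List.Relation.Binary.Permutation.Propositional.Properties as ↭
import Data.List.Relation.Binary.Permutation.Setoid.Properties as ↭ₛ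
open import Data.List.Relation.Binary.Prefix.Heterogeneous using ([]; _∷_)
open import Data.List.Relation.Binary.Subset.Propositional using (_⊆_)
open import Data.List.Relation.Unary.All as All using (All; []; _∷_)
import Data.List.Relation.Unary.All.Properties as All
open import Data.List.Relation.Unary.AllPairs as AllPairs using ([]; _∷_)
open import Data.List.Relation.Unary.Any as Any using (here; there)
open import Data.List.Relation.Unary.Linked as Linked using (Linked; []; [-]; _∷_)
open import Data.List.Relation.Unary.Linked.Properties using (Linked⇒AllPairs)
open import Data.List.Relation.Unary.Unique.Propositional using (Unique)
import Data.List.Relation.Unary.Unique.Propositional.Properties as Unique
open import Data.Nat.Base as ℕ using (ℕ; zero; suc; z≤n; s≤s; z<s)
open import Data.Nat.Divisibility using (_∣_; divides; ∣m∣n⇒∣m+n; ∣m+n∣m⇒∣n; ∣-refl; ∣⇒≤; _∣0)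
open import Data.Nat.ListAction using (sum)
import Data.Nat.Properties as ℕ
open import Data.Nat.Tactic.RingSolver using (solve-∀)
open import Data.Product.Base using (_×_; _,_; ∃; proj₁; proj₂)
open import Data.Sum.Base using (_⊎_; inj₁; inj₂)
open import Function.Base using (_∘_)
import Relation.Binary.Reasoning.Setoid as SetoidReasoning
open import Relation.Binary.PropositionalEquality as ≡ using (_≡_; _≢_)
open import Relation.Nullary.Negation.Core using (¬_; contradiction)
open import Relation.Unary using (U)
open import Defs

-- Formal power series

-- The infinite series F is never formed. Only the parts in the first `M` blocks are kept, so each
-- class of partitions is an explicit duplicate-free list, which is the kind of witness that
-- `HasSum` demands. The equation for F then relates four consecutive truncations, hence the four
-- arguments of `Recurrence`. Uniqueness becomes q-adic convergence, uniform in the degree in x: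
-- each application of the relation makes one more power of q agree. Modulo q^0 everything agrees,
-- so the induction starts from nothing; only the constant term in x, to which the substitution of
-- xq² for x brings no power of q, has to be compared separately. Both identities are treated at
-- once: the blocks start after an even number `b`, and raising all parts by `b` is the substitution
-- of xq^b for x. The values b = 0 and b = 2 give the two claims. Equations between series are kept
-- free of subtraction, the negative terms being moved to the other side, so that they reduce to
-- identities in commutative semirings.

module PowerSeries {c ℓ} (R : CommutativeRing c ℓ) where

  private module R = CommutativeRing R
  open R using (Carrier; _≈_; 0#; 1#)
  open SetoidReasoning R.setoid
  open Solver R.commutativeSemiring using (solve; _:+_; _:*_; _:=_)

  Series : Set c
  Series = ℕ → Carrier

  infix 4 _≋_
  record _≋_ (f g : Series) : Set ℓ where
    constructor pointwise
    field at : ∀ n → f n ≈ g n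
  open _≋_ public

  tail : Series → Series
  tail f n = f (suc n)

  const : Carrier → Series
  const r zero    = r
  const r (suc _) = 0#

  shift : Series → Series
  shift f zero    = 0#
  shift f (suc n) = f n

  infixl 6 _⊕_
  infixl 7 _⊛_
  _⊕_ _⊛_ : Series → Series → Series
  (f ⊕ g) n = f n R.+ g n
  (f ⊛ g) zero    = f 0 R.* g 0
  (f ⊛ g) (suc n) = f 0 R.* g (suc n) R.+ (tail f ⊛ g) n

  ⊝_ : Series → Series
  (⊝ f) n = R.- f n

  -- Stated for each `n`, not only as a congruence, so that a factor inside a product can be
  -- replaced by a truncation or by a series congruent to it modulo a power of the variable.
  ⊛-local : ∀ n {f f′ g g′ : Series} →
            (∀ k → k ℕ.≤ n → f k ≈ f′ k) → (∀ k → k ℕ.≤ n → g k ≈ g′ k) →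
            (f ⊛ g) n ≈ (f′ ⊛ g′) n
  ⊛-local zero    p q = R.*-cong (p 0 z≤n) (q 0 z≤n)
  ⊛-local (suc n) p q = R.+-cong
    (R.*-cong (p 0 z≤n) (q (suc n) ℕ.≤-refl))
    (⊛-local n (λ k k≤n → p (suc k) (s≤s k≤n)) (λ k k≤n → q k (ℕ.m≤n⇒m≤1+n k≤n)))

  ⊛-cong : ∀ {f f′ g g′} → f ≋ f′ → g ≋ g′ → f ⊛ g ≋ f′ ⊛ g′
  ⊛-cong p q .at n = ⊛-local n (λ k _ → p .at k) (λ k _ → q .at k)

  ⊛-distribʳ-at : ∀ h f g n → ((f ⊕ g) ⊛ h) n ≈ (f ⊛ h) n R.+ (g ⊛ h) n
  ⊛-distribʳ-at h f g zero    = R.distribʳ _ _ _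
  ⊛-distribʳ-at h f g (suc n) = begin
    (f 0 R.+ g 0) R.* h (suc n) R.+ ((tail f ⊕ tail g) ⊛ h) n
      ≈⟨ R.+-congˡ (⊛-distribʳ-at h (tail f) (tail g) n) ⟩
    (f 0 R.+ g 0) R.* h (suc n) R.+ ((tail f ⊛ h) n R.+ (tail g ⊛ h) n)
      ≈⟨ solve 5 (λ a b k u v → (a :+ b) :* k :+ (u :+ v) := (a :* k :+ u) :+ (b :* k :+ v))
           R.refl (f 0) (g 0) (h (suc n)) _ _ ⟩
    (f 0 R.* h (suc n) R.+ (tail f ⊛ h) n) R.+ (g 0 R.* h (suc n) R.+ (tail g ⊛ h) n) ∎

  ⊛-scale-at : ∀ r f g n → ((λ k → r R.* f k) ⊛ g) n ≈ r R.* (f ⊛ g) n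
  ⊛-scale-at r f g zero    = R.*-assoc _ _ _
  ⊛-scale-at r f g (suc n) = begin
    r R.* f 0 R.* g (suc n) R.+ ((λ k → r R.* tail f k) ⊛ g) n
      ≈⟨ R.+-cong (R.*-assoc _ _ _) (⊛-scale-at r (tail f) g n) ⟩
    r R.* (f 0 R.* g (suc n)) R.+ r R.* (tail f ⊛ g) n
      ≈⟨ R.distribˡ _ _ _ ⟨
    r R.* (f 0 R.* g (suc n) R.+ (tail f ⊛ g) n) ∎

  ⊛-assoc-at : ∀ f g h n → ((f ⊛ g) ⊛ h) n ≈ (f ⊛ (g ⊛ h)) n
  ⊛-assoc-at f g h zero    = R.*-assoc _ _ _
  ⊛-assoc-at f g h (suc n) = begin
    f 0 R.* g 0 R.* h (suc n) R.+ (((λ k → f 0 R.* tail g k) ⊕ (tail f ⊛ g)) ⊛ h) n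
      ≈⟨ R.+-congˡ (⊛-distribʳ-at h _ _ n) ⟩
    f 0 R.* g 0 R.* h (suc n) R.+ (((λ k → f 0 R.* tail g k) ⊛ h) n R.+ ((tail f ⊛ g) ⊛ h) n)
      ≈⟨ R.+-congˡ (R.+-cong (⊛-scale-at (f 0) (tail g) h n) (⊛-assoc-at (tail f) g h n)) ⟩
    f 0 R.* g 0 R.* h (suc n) R.+ (f 0 R.* (tail g ⊛ h) n R.+ (tail f ⊛ (g ⊛ h)) n)
      ≈⟨ solve 5 (λ a b k u v → a :* b :* k :+ (a :* u :+ v) := a :* (b :* k :+ u) :+ v)
           R.refl (f 0) (g 0) (h (suc n)) _ _ ⟩
    f 0 R.* (g 0 R.* h (suc n) R.+ (tail g ⊛ h) n) R.+ (tail f ⊛ (g ⊛ h)) n ∎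

  -- The product is defined by peeling coefficients off the left factor; peeling them off the right
  -- factor as well is what turns commutativity into an induction.
  ⊛-sucʳ : ∀ f g n → (f ⊛ g) (suc n) ≈ f (suc n) R.* g 0 R.+ (f ⊛ tail g) n
  ⊛-sucʳ f g zero    = R.+-comm _ _
  ⊛-sucʳ f g (suc n) = begin
    f 0 R.* g (2 ℕ.+ n) R.+ (tail f ⊛ g) (suc n)
      ≈⟨ R.+-congˡ (⊛-sucʳ (tail f) g n) ⟩
    f 0 R.* g (2 ℕ.+ n) R.+ (f (2 ℕ.+ n) R.* g 0 R.+ (tail f ⊛ tail g) n)
      ≈⟨ solve 3 (λ u v w → u :+ (v :+ w) := v :+ (u :+ w)) R.refl _ _ _ ⟩
    f (2 ℕ.+ n) R.* g 0 R.+ (f 0 R.* g (2 ℕ.+ n) R.+ (tail f ⊛ tail g) n) ∎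

  ⊛-comm-at : ∀ f g n → (f ⊛ g) n ≈ (g ⊛ f) n
  ⊛-comm-at f g zero    = R.*-comm _ _
  ⊛-comm-at f g (suc n) = begin
    f 0 R.* g (suc n) R.+ (tail f ⊛ g) n  ≈⟨ R.+-cong (R.*-comm _ _) (⊛-comm-at (tail f) g n) ⟩
    g (suc n) R.* f 0 R.+ (g ⊛ tail f) n  ≈⟨ ⊛-sucʳ g f n ⟨
    (g ⊛ f) (suc n)                       ∎

  0⊛-at : ∀ f n → (const 0# ⊛ f) n ≈ 0#
  0⊛-at f zero    = R.zeroˡ _
  0⊛-at f (suc n) = R.trans
    (R.+-cong (R.zeroˡ _) (R.trans (⊛-local n (λ { zero _ → R.refl ; (suc _) _ → R.refl }) (λ _ _ →
        R.refl)) (0⊛-at f n)))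
    (R.+-identityˡ _)

  const⊛-at : ∀ r f n → (const r ⊛ f) n ≈ r R.* f n
  const⊛-at r f zero    = R.refl
  const⊛-at r f (suc n) = R.trans
    (R.+-congˡ (R.trans (⊛-local n (λ { zero _ → R.refl ; (suc _) _ → R.refl }) (λ _ _ → R.refl))
        (0⊛-at f n)))
    (R.+-identityʳ _)

  shift⊛-at : ∀ f g n → (shift f ⊛ g) n ≈ shift (f ⊛ g) n
  shift⊛-at f g zero    = R.zeroˡ _
  shift⊛-at f g (suc n) = R.trans (R.+-congʳ (R.zeroˡ _)) (R.+-identityˡ _)

  isCommutativeRing : IsCommutativeRing _≋_ _⊕_ _⊛_ ⊝_ (λ _ → 0#) (const 1#)
  isCommutativeRing = record
    { isRing = record
      { +-isAbelianGroup = record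
        { isGroup = record
          { isMonoid = record
            { isSemigroup = record
              { isMagma = record
                { isEquivalence = record
                  { refl  = pointwise λ _ → R.refl
                  ; sym   = λ p → pointwise λ n → R.sym (p .at n)
                  ; trans = λ p q → pointwise λ n → R.trans (p .at n) (q .at n) }
                ; ∙-cong = λ p q → pointwise λ n → R.+-cong (p .at n) (q .at n) }
              ; assoc = λ f g h → pointwise λ n → R.+-assoc (f n) (g n) (h n) }
            ; identity = (λ f → pointwise λ n → R.+-identityˡ (f n))
                       , (λ f → pointwise λ n → R.+-identityʳ (f n)) }
          ; inverse = (λ f → pointwise λ n → R.-‿inverseˡ (f n))
                    , (λ f → pointwise λ n → R.-‿inverseʳ (f n))
          ; ⁻¹-cong = λ p → pointwise λ n → R.-‿cong (p .at n) }
        ; comm = λ f g → pointwise λ n → R.+-comm (f n) (g n) }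
      ; *-cong = ⊛-cong
      ; *-assoc = λ f g h → pointwise (⊛-assoc-at f g h)
      ; *-identity = (λ f → pointwise λ n → R.trans (const⊛-at 1# f n) (R.*-identityˡ (f n)))
                   , (λ f → pointwise λ n → R.trans (⊛-comm-at f (const 1#) n)
                                              (R.trans (const⊛-at 1# f n) (R.*-identityˡ (f n))))
      ; distrib = (λ h f g → pointwise λ n → R.trans (⊛-comm-at h (f ⊕ g) n)
                     (R.trans (⊛-distribʳ-at h f g n) (R.+-cong (⊛-comm-at f h n) (⊛-comm-at g h n))))
                , (λ h f g → pointwise (⊛-distribʳ-at h f g)) }
    ; *-comm = λ f g → pointwise (⊛-comm-at f g) }

  commutativeRing : CommutativeRing c ℓ
  commutativeRing = record { isCommutativeRing = isCommutativeRing }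

  X : Series
  X = shift (const 1#)

-- Finite sums over lists

module _ {c ℓ} (R : CommutativeRing c ℓ) where
  open CommutativeRing R
  open SetoidReasoning setoid

  ∑L : {I : Set} → (I → Carrier) → List I → Carrier
  ∑L f L = foldr _+_ 0# (map f L)

  ∑L-cong : {I : Set} {f g : I → Carrier} → (∀ i → f i ≈ g i) → ∀ L → ∑L f L ≈ ∑L g L
  ∑L-cong p []      = refl
  ∑L-cong p (i ∷ L) = +-cong (p i) (∑L-cong p L)

  ∑L-++ : {I : Set} (f : I → Carrier) → ∀ L L′ → ∑L f (L ++ L′) ≈ ∑L f L + ∑L f L′
  ∑L-++ f []      L′ = sym (+-identityˡ _)
  ∑L-++ f (i ∷ L) L′ = trans (+-congˡ (∑L-++ f L L′)) (sym (+-assoc _ _ _))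

  ∑L-map : {I J : Set} (f : J → Carrier) (h : I → J) → ∀ L → ∑L f (map h L) ≈ ∑L (f ∘ h) L
  ∑L-map f h []      = refl
  ∑L-map f h (i ∷ L) = +-congˡ (∑L-map f h L)

  ∑L-*ˡ : {I : Set} (r : Carrier) (f : I → Carrier) → ∀ L → ∑L (λ i → r * f i) L ≈ r * ∑L f L
  ∑L-*ˡ r f []      = sym (zeroʳ r)
  ∑L-*ˡ r f (i ∷ L) = trans (+-congˡ (∑L-*ˡ r f L)) (sym (distribˡ _ _ _))

  ∑L-cartesianProduct : {I J : Set} (f : I → Carrier) (g : J → Carrier) → ∀ L L′ →
    ∑L (λ (i , j) → f i * g j) (cartesianProduct L L′) ≈ ∑L f L * ∑L g L′
  ∑L-cartesianProduct f g []      L′ = sym (zeroˡ _)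
  ∑L-cartesianProduct f g (i ∷ L) L′ = begin
    ∑L h (map (i ,_) L′ ++ cartesianProduct L L′)
      ≈⟨ ∑L-++ h (map (i ,_) L′) _ ⟩
    ∑L h (map (i ,_) L′) + ∑L h (cartesianProduct L L′)
      ≈⟨ +-cong (trans (∑L-map h (i ,_) L′) (∑L-*ˡ (f i) g L′)) (∑L-cartesianProduct f g L L′) ⟩
    f i * ∑L g L′ + ∑L f L * ∑L g L′
      ≈⟨ distribʳ _ _ _ ⟨
    ∑L f (i ∷ L) * ∑L g L′ ∎
    where
    h = λ (i , j) → f i * g j

-- Inverses and geometric sums

module Inverses {c ℓ} (R : CommutativeRing c ℓ) where
  open CommutativeRing R
  open SetoidReasoning setoid
  open Solver commutativeSemiring using (solve; con; _:+_; _:*_; _:=_)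

  x+[1-x]≈1 : ∀ x → x + (1# - x) ≈ 1#
  x+[1-x]≈1 x = begin
    x + (1# - x)    ≈⟨ solve 2 (λ x y → x :+ (con 1 :+ y) := con 1 :+ (x :+ y)) refl x (- x) ⟩
    1# + (x - x)    ≈⟨ +-congˡ (-‿inverseʳ x) ⟩
    1# + 0#         ≈⟨ +-identityʳ 1# ⟩
    1#              ∎

  -- Induction step for f (1 + g + ... + g^(M-1)) + g^M = 1 with g = 1 - f; `s` is the partial sum
  -- and `p` the power g^M.
  geometric-step : ∀ {f g s p} → f + g ≈ 1# → f * s + p ≈ 1# → f * (s + p) + g * p ≈ 1#
  geometric-step {f} {g} {s} {p} f+g ih = begin
    f * (s + p) + g * p
      ≈⟨ solve 4 (λ f s p g → f :* (s :+ p) :+ g :* p := f :* s :+ (f :+ g) :* p) refl f s p g ⟩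
    f * s + (f + g) * p  ≈⟨ +-congˡ (trans (*-congʳ f+g) (*-identityˡ p)) ⟩
    f * s + p            ≈⟨ ih ⟩
    1#                   ∎

  inverse-unique : ∀ {f u v} → f * u ≈ 1# → f * v ≈ 1# → u ≈ v
  inverse-unique {f} {u} {v} fu fv = begin
    u            ≈⟨ *-identityʳ u ⟨
    u * 1#       ≈⟨ *-congˡ fv ⟨
    u * (f * v)  ≈⟨ solve 3 (λ u f v → u :* (f :* v) := f :* u :* v) refl u f v ⟩
    f * u * v    ≈⟨ *-congʳ fu ⟩
    1# * v       ≈⟨ *-identityˡ v ⟩
    v            ∎

  -- Both `u` and (1 - r) u′ invert `p`, so they coincide. Used with u = 1/(a;a)ₙ, u′ = 1/(a;a)ₙ₊₁
  -- and r = a^(n+1).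
  inverse-factor : ∀ {p r u u′} → p * u ≈ 1# → p * ((1# - r) * u′) ≈ 1# → u′ ≈ r * u′ + u
  inverse-factor {p} {r} {u} {u′} pu pu′ = begin
    u′                        ≈⟨ *-identityˡ u′ ⟨
    1# * u′                   ≈⟨ *-congʳ (x+[1-x]≈1 r) ⟨
    (r + (1# - r)) * u′       ≈⟨ distribʳ u′ r (1# - r) ⟩
    r * u′ + (1# - r) * u′    ≈⟨ +-congˡ (inverse-unique pu′ pu) ⟩
    r * u′ + u                ∎

-- The substitution of rx for x, and series in powers of x^(1+p)

module Dilation {c ℓ} (R : CommutativeRing c ℓ) where

  open PowerSeries R public
  private module R = CommutativeRing R
  open R using (Carrier; _≈_; 0#; 1#)
  open Exp R.semiring using (_^_; ^-congˡ)
  open CExp R.commutativeSemiring using (^-distrib-*)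
  open CommutativeRing commutativeRing
    using (_+_; _*_; refl; sym; trans; +-cong; +-congˡ; +-congʳ; *-congˡ; *-congʳ; *-assoc;
      *-identityˡ; distribˡ)
  module S = CommutativeRing commutativeRing
  open Exp S.semiring public using () renaming (_^_ to _^ₛ_)
  module ≈R = SetoidReasoning R.setoid
  module ≋R = SetoidReasoning S.setoid
  module RSolver = Solver R.commutativeSemiring
  module SSolver = Solver S.commutativeSemiring

  X*-at : ∀ f → X * f ≋ shift f
  X*-at f .at zero    = R.zeroˡ _
  X*-at f .at (suc n) = R.trans (shift⊛-at (const 1#) f (suc n))
                            (R.trans (const⊛-at 1# f n) (R.*-identityˡ _))

  const-cong : ∀ {r s} → r ≈ s → const r ≋ const s
  const-cong p .at zero    = p
  const-cong p .at (suc n) = R.refl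

  const-* : ∀ r s → const (r R.* s) ≋ const r * const s
  const-* r s .at zero    = R.refl
  const-* r s .at (suc n) = R.sym (R.trans (const⊛-at r (const s) (suc n)) (R.zeroʳ r))

  const-^ : ∀ r n → const (r ^ n) ≋ const r ^ₛ n
  const-^ r zero    = refl
  const-^ r (suc n) = trans (const-* r (r ^ n)) (*-congˡ (const-^ r n))

  σ : Carrier → Series → Series
  σ r f n = r ^ n R.* f n

  σ-cong : ∀ {r f g} → f ≋ g → σ r f ≋ σ r g
  σ-cong p .at n = R.*-congˡ (p .at n)

  σ-congˡ : ∀ {r s} f → r ≈ s → σ r f ≋ σ s f
  σ-congˡ f p .at n = R.*-congʳ (^-congˡ n p)

  σ-+ : ∀ r f g → σ r (f + g) ≋ σ r f + σ r g
  σ-+ r f g .at n = R.distribˡ _ _ _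

  σ-*-at : ∀ r f g n → σ r (f * g) n ≈ (σ r f * σ r g) n
  σ-*-at r f g zero    = RSolver.solve 2 (λ a b → con 1 :* (a :* b) := con 1 :* a :* (con 1 :* b))
      R.refl (f 0) (g 0)
    where open RSolver
  σ-*-at r f g (suc n) = begin
    r R.* r ^ n R.* (f 0 R.* g (suc n) R.+ (tail f * g) n)
      ≈⟨ solve 5 (λ r p a b u → r :* p :* (a :* b :+ u) := (con 1 :* a) :* (r :* p :* b)
          :+ r :* (p :* u))
           R.refl r (r ^ n) (f 0) (g (suc n)) _ ⟩
    1# R.* f 0 R.* (r R.* r ^ n R.* g (suc n)) R.+ r R.* σ r (tail f * g) n
      ≈⟨ R.+-congˡ (R.*-congˡ (σ-*-at r (tail f) g n)) ⟩
    1# R.* f 0 R.* (r R.* r ^ n R.* g (suc n)) R.+ r R.* (σ r (tail f) * σ r g) n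
      ≈⟨ R.+-congˡ (⊛-scale-at r (σ r (tail f)) (σ r g) n) ⟨
    1# R.* f 0 R.* (r R.* r ^ n R.* g (suc n)) R.+ ((λ k → r R.* σ r (tail f) k) * σ r g) n
      ≈⟨ R.+-congˡ (⊛-local n (λ k _ → R.*-assoc r (r ^ k) (f (suc k))) (λ _ _ → R.refl)) ⟨
    (σ r f * σ r g) (suc n) ∎
    where
    open ≈R
    open RSolver

  σ-* : ∀ r f g → σ r (f * g) ≋ σ r f * σ r g
  σ-* r f g .at = σ-*-at r f g

  σ-const : ∀ r s → σ r (const s) ≋ const s
  σ-const r s .at zero    = R.*-identityˡ s
  σ-const r s .at (suc n) = R.zeroʳ _

  σ-X : ∀ r → σ r X ≋ const r * X
  σ-X r .at zero          = R.trans (R.zeroʳ _) (R.sym (R.zeroʳ _))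
  σ-X r .at (suc zero)    = R.trans (R.*-congʳ (R.*-identityʳ r)) (R.sym (const⊛-at r X 1))
  σ-X r .at (suc (suc n)) = R.trans (R.zeroʳ _)
      (R.sym (R.trans (const⊛-at r X (suc (suc n))) (R.zeroʳ _)))

  σ-∘ : ∀ r s f → σ r (σ s f) ≋ σ (r R.* s) f
  σ-∘ r s f .at n = R.trans (R.sym (R.*-assoc _ _ _)) (R.*-congʳ (R.sym (^-distrib-* r s n)))

  -- ∑ⱼ bⱼ x^(c + (1 + p) j)
  strided : ℕ → Series → ℕ → Series
  strided p b zero    zero    = b 0
  strided p b zero    (suc n) = strided p (tail b) p n
  strided p b (suc c) zero    = 0#
  strided p b (suc c) (suc n) = strided p b c n

  strided-suc : ∀ p b c → strided p b (suc c) ≋ X * strided p b c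
  strided-suc p b c = trans (pointwise λ { zero → R.refl ; (suc n) → R.refl }) (sym (X*-at _))

  strided-delay : ∀ p b c → strided p b c ≋ X ^ₛ c * strided p b 0
  strided-delay p b zero    = sym (*-identityˡ _)
  strided-delay p b (suc c) = trans (strided-suc p b c)
    (trans (*-congˡ (strided-delay p b c)) (sym (*-assoc _ _ _)))

  strided-zero : ∀ p b → strided p b 0 ≋ const (b 0) + X ^ₛ suc p * strided p (tail b) 0
  strided-zero p b = begin
    strided p b 0                                      ≈⟨ pointwise split ⟩
    const (b 0) + shift (strided p (tail b) p)         ≈⟨ +-congˡ (X*-at _) ⟨
    const (b 0) + X * strided p (tail b) p
        ≈⟨ +-congˡ (*-congˡ (strided-delay p (tail b) p)) ⟩
    const (b 0) + X * (X ^ₛ p * strided p (tail b) 0)  ≈⟨ +-congˡ (*-assoc _ _ _) ⟨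
    const (b 0) + X ^ₛ suc p * strided p (tail b) 0    ∎
    where
    open ≋R
    split : ∀ n → strided p b 0 n ≈ (const (b 0) + shift (strided p (tail b) p)) n
    split zero    = R.sym (R.+-identityʳ _)
    split (suc n) = R.sym (R.+-identityˡ _)

  strided-cong : ∀ p {b b′} c n → (∀ j → b j ≈ b′ j) → strided p b c n ≈ strided p b′ c n
  strided-cong p zero    zero    eq = eq 0
  strided-cong p zero    (suc n) eq = strided-cong p p n (eq ∘ suc)
  strided-cong p (suc c) zero    eq = R.refl
  strided-cong p (suc c) (suc n) eq = strided-cong p c n eq

  strided-+ : ∀ p b b′ c n → strided p (b + b′) c n ≈ strided p b c n R.+ strided p b′ c n
  strided-+ p b b′ zero    zero    = R.refl
  strided-+ p b b′ zero    (suc n) = strided-+ p (tail b) (tail b′) p n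
  strided-+ p b b′ (suc c) zero    = R.sym (R.+-identityʳ _)
  strided-+ p b b′ (suc c) (suc n) = strided-+ p b b′ c n

  strided-scale : ∀ p r b c n → strided p (λ j → r R.* b j) c n ≈ r R.* strided p b c n
  strided-scale p r b zero    zero    = R.refl
  strided-scale p r b zero    (suc n) = strided-scale p r (tail b) p n
  strided-scale p r b (suc c) zero    = R.sym (R.zeroʳ _)
  strided-scale p r b (suc c) (suc n) = strided-scale p r b c n

  -- Under the substitution of rx for x, the monomial x^(c + (1+p) j) picks up the factor r^c
  -- (r^(1+p))^j.
  strided-σ : ∀ p r b c n → r ^ n R.* strided p b c n ≈ r ^ c R.* strided p (σ (r ^ suc p) b) c n
  strided-σ p r b zero zero = R.*-congˡ (R.sym (R.*-identityˡ _))
  strided-σ p r b zero (suc n) = begin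
    r R.* r ^ n R.* strided p (tail b) p n
      ≈⟨ R.*-assoc _ _ _ ⟩
    r R.* (r ^ n R.* strided p (tail b) p n)
      ≈⟨ R.*-congˡ (strided-σ p r (tail b) p n) ⟩
    r R.* (r ^ p R.* strided p (σ (r ^ suc p) (tail b)) p n)
      ≈⟨ R.*-assoc _ _ _ ⟨
    r ^ suc p R.* strided p (σ (r ^ suc p) (tail b)) p n
      ≈⟨ strided-scale p (r ^ suc p) _ p n ⟨
    strided p (λ j → r ^ suc p R.* ((r ^ suc p) ^ j R.* b (suc j))) p n
      ≈⟨ strided-cong p p n (λ j → R.*-assoc _ _ _) ⟨
    strided p (tail (σ (r ^ suc p) b)) p n
      ≈⟨ R.*-identityˡ _ ⟨
    1# R.* strided p (tail (σ (r ^ suc p) b)) p n ∎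
    where open ≈R
  strided-σ p r b (suc c) zero = R.trans (R.zeroʳ _) (R.sym (R.zeroʳ _))
  strided-σ p r b (suc c) (suc n) = begin
    r R.* r ^ n R.* strided p b c n    ≈⟨ R.*-assoc _ _ _ ⟩
    r R.* (r ^ n R.* strided p b c n)  ≈⟨ R.*-congˡ (strided-σ p r b c n) ⟩
    r R.* (r ^ c R.* _)                ≈⟨ R.*-assoc _ _ _ ⟨
    r R.* r ^ c R.* _                  ∎
    where open ≈R

  -- Translates first-order recurrences between coefficients into equations between series: the
  -- index shift of `w` is multiplication by x^(1+p).
  strided-recurrence : ∀ p {u v w} → u 0 ≈ v 0 → (∀ j → u (suc j) ≈ v (suc j) R.+ w j) →
    strided p u 0 ≋ strided p v 0 + X ^ₛ suc p * strided p w 0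
  strided-recurrence p {u} {v} {w} eq₀ eq = begin
    strided p u 0
      ≈⟨ strided-zero p u ⟩
    const (u 0) + X ^ₛ suc p * strided p (tail u) 0
      ≈⟨ +-cong (const-cong eq₀) (*-congˡ (pointwise λ n →
           R.trans (strided-cong p 0 n eq) (strided-+ p (tail v) w 0 n))) ⟩
    const (v 0) + X ^ₛ suc p * (strided p (tail v) 0 + strided p w 0)
      ≈⟨ trans (+-congˡ (distribˡ _ _ _)) (sym (S.+-assoc _ _ _)) ⟩
    const (v 0) + X ^ₛ suc p * strided p (tail v) 0 + X ^ₛ suc p * strided p w 0
      ≈⟨ +-congʳ (strided-zero p v) ⟨
    strided p v 0 + X ^ₛ suc p * strided p w 0 ∎
    where open ≋R

  -- The first `M` terms of `strided p b 0`, in Horner form.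
  partial : ℕ → Series → ℕ → Series
  partial p b zero    = S.0#
  partial p b (suc M) = const (b 0) + X ^ₛ suc p * partial p (tail b) M

  -- Besides truncations in x, this serves over ℤ, where the variable is q: multiplying by q^c
  -- improves a congruence modulo q^M to one modulo q^(c+M).
  X^*-local : ∀ c {f g : Series} {M} → (∀ n → n ℕ.< M → f n ≈ g n) →
              ∀ n → n ℕ.< c ℕ.+ M → (X ^ₛ c * f) n ≈ (X ^ₛ c * g) n
  X^*-local zero    p n       n<M       = ⊛-local n (λ _ _ → R.refl) (λ k k≤n →
      p k (ℕ.≤-<-trans k≤n n<M))
  X^*-local (suc c) {f} {g} p n n<cM    = R.trans (step f n) (R.trans (go n n<cM) (R.sym (step g n)))
    where
    step : ∀ f n → (X ^ₛ suc c * f) n ≈ shift (X ^ₛ c * f) n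
    step f n = R.trans (*-assoc X (X ^ₛ c) f .at n) (X*-at _ .at n)
    go : ∀ n → n ℕ.< suc c ℕ.+ _ → shift (X ^ₛ c * f) n ≈ shift (X ^ₛ c * g) n
    go zero    _          = R.refl
    go (suc n) (s≤s n<cM) = X^*-local c p n n<cM

  partial-strided : ∀ p b M n → n ℕ.< M → partial p b M n ≈ strided p b 0 n
  partial-strided p b (suc M) n n<M = R.trans
    (R.+-congˡ (X^*-local (suc p) (partial-strided p (tail b) M) n (ℕ.≤-trans n<M (s≤s (ℕ.m≤n+m M p)))))
    (R.sym (strided-zero p b .at n))

  -- The factor `y` makes the induction go through: it absorbs one x^(1+p) each time the first index
  -- is dropped.
  ∑L-partial : ∀ {I : Set} p b M (y : Series) (h : I → Series) (g : ℕ → I) →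
    (∀ j → h (g j) ≋ y * (const (b j) * X ^ₛ (suc p ℕ.* j))) →
    ∑L commutativeRing h (applyUpTo g M) ≋ y * partial p b M
  ∑L-partial p b zero    y h g eq = sym (S.zeroʳ y)
  ∑L-partial p b (suc M) y h g eq = begin
    h (g 0) + ∑L commutativeRing h (applyUpTo (g ∘ suc) M)
      ≈⟨ +-cong (trans (eq 0) (*-congˡ (trans (*-congˡ (S.reflexive (≡.cong (X ^ₛ_) (ℕ.*-zeroʳ p))))
          (S.*-identityʳ _))))
                (∑L-partial p (tail b) M (y * X ^ₛ suc p) h (g ∘ suc) eq′) ⟩
    y * const (b 0) + y * X ^ₛ suc p * partial p (tail b) M
      ≈⟨ trans (+-congˡ (*-assoc _ _ _)) (sym (distribˡ _ _ _)) ⟩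
    y * partial p b (suc M) ∎
    where
    open ≋R
    eq′ : ∀ j → h (g (suc j)) ≋ y * X ^ₛ suc p * (const (b (suc j)) * X ^ₛ (suc p ℕ.* j))
    eq′ j = begin
      h (g (suc j))
        ≈⟨ eq (suc j) ⟩
      y * (const (b (suc j)) * X ^ₛ (suc p ℕ.* suc j))
        ≈⟨ *-congˡ (*-congˡ (S.reflexive (≡.cong (X ^ₛ_) (ℕ.*-suc (suc p) j)))) ⟩
      y * (const (b (suc j)) * X ^ₛ (suc p ℕ.+ suc p ℕ.* j))
        ≈⟨ *-congˡ (*-congˡ (Exp.^-homo-* S.semiring X (suc p) _)) ⟩
      y * (const (b (suc j)) * (X ^ₛ suc p * X ^ₛ (suc p ℕ.* j)))
        ≈⟨ solve 4 (λ y c u v → y :* (c :* (u :* v)) := y :* u :* (c :* v)) refl y _ (X ^ₛ suc p) _ ⟩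
      y * X ^ₛ suc p * (const (b (suc j)) * X ^ₛ (suc p ℕ.* j)) ∎
      where open SSolver using (solve; _:*_; _:=_)

-- The functional equation

module _ {c ℓ} (R : CommutativeRing c ℓ) where
  open CommutativeRing R
  open SetoidReasoning setoid
  open Solver commutativeSemiring using (solve; con; _:+_; _:*_; _:=_)

  -- Used with u = xq, v = x²q, y = xq²; the subscripts 1 and 2 stand for the arguments xq and xq².
  -- The hypotheses say (1-u)A = A₁, (1-y)A₁ = A₂, (1-v)B = B₂ and D = (1-y³)D₂, so that
  -- (1-u)(1-v)ABD = A₁B₂D and only A₁D remains to be rewritten.
  product-recurrence : ∀ {u v y A A₁ A₂ B B₂ D D₂} →
    A ≈ A₁ + u * A → A₁ ≈ A₂ + y * A₁ → B ≈ B₂ + v * B → D + y * y * y * D₂ ≈ D₂ →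
    A * B * D + u * v * (A * B * D) ≈
    (1# + y + y * y) * (A₂ * B₂ * D₂) + u * (A * B * D) + v * (A * B * D)
  product-recurrence {u} {v} {y} {A} {A₁} {A₂} {B} {B₂} {D} {D₂} a a₁ b d = begin
    A * B * D + u * v * (A * B * D)
      ≈⟨ +-congʳ (*-congʳ (*-congʳ a)) ⟩
    (A₁ + u * A) * B * D + u * v * (A * B * D)
      ≈⟨ solve 6 (λ A A₁ B D u v → (A₁ :+ u :* A) :* B :* D :+ u :* v :* (A :* B :* D)
                   := A₁ :* B :* D :+ u :* v :* (A :* B :* D) :+ u :* (A :* B :* D)) refl A A₁ B D u v ⟩
    A₁ * B * D + u * v * (A * B * D) + u * (A * B * D)
      ≈⟨ +-congʳ (+-congʳ (*-congʳ (*-congˡ b))) ⟩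
    A₁ * (B₂ + v * B) * D + u * v * (A * B * D) + u * (A * B * D)
      ≈⟨ solve 7 (λ A A₁ B B₂ D u v → A₁ :* (B₂ :+ v :* B) :* D :+ u :* v :* (A :* B :* D)
          :+ u :* (A :* B :* D)
                   := A₁ :* D :* B₂ :+ u :* (A :* B :* D) :+ v :* ((A₁ :+ u :* A) :* B :* D))
                       refl A A₁ B B₂ D u v ⟩
    A₁ * D * B₂ + u * (A * B * D) + v * ((A₁ + u * A) * B * D)
      ≈⟨ +-cong (+-congʳ (*-congʳ A₁D)) (*-congˡ (*-congʳ (*-congʳ (sym a)))) ⟩
    (1# + y + y * y) * (A₂ * D₂) * B₂ + u * (A * B * D) + v * (A * B * D)
      ≈⟨ +-congʳ (+-congʳ (solve 4 (λ p a b d → p :* (a :* d) :* b := p :* (a :* b :* d))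
          refl (1# + y + y * y) A₂ B₂ D₂)) ⟩
    (1# + y + y * y) * (A₂ * B₂ * D₂) + u * (A * B * D) + v * (A * B * D) ∎
    where
    -- 1 - y³ = (1 - y)(1 + y + y²)
    A₁D : A₁ * D ≈ (1# + y + y * y) * (A₂ * D₂)
    A₁D = GroupProperties.∙-cancelʳ +-group (y * y * y * (A₁ * D₂)) _ _ (begin
      A₁ * D + y * y * y * (A₁ * D₂)
        ≈⟨ solve 4 (λ a d e y → a :* d :+ y :* y :* y :* (a :* e) := a :* (d :+ y :* y :* y :* e))
            refl A₁ D D₂ y ⟩
      A₁ * (D + y * y * y * D₂)  ≈⟨ *-cong a₁ d ⟩
      (A₂ + y * A₁) * D₂         ≈⟨ *-congʳ (+-congˡ (*-congˡ a₁)) ⟩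
      -- Three uses of `a₁` give A₁ = (1 + y + y²) A₂ + y³ A₁; the last summand is cancelled
      -- additively, so nothing is divided by 1 - y.
      (A₂ + y * (A₂ + y * A₁)) * D₂ ≈⟨ *-congʳ (+-congˡ (*-congˡ (+-congˡ (*-congˡ a₁)))) ⟩
      (A₂ + y * (A₂ + y * (A₂ + y * A₁))) * D₂
        ≈⟨ solve 4 (λ a b d y → (b :+ y :* (b :+ y :* (b :+ y :* a))) :* d
                     := (con 1 :+ y :+ y :* y) :* (b :* d) :+ y :* y :* y :* (a :* d)) refl A₁ A₂ D₂ y ⟩
      (1# + y + y * y) * (A₂ * D₂) + y * y * y * (A₁ * D₂) ∎)

module FunctionalEquation {c ℓ} (R : CommutativeRing c ℓ) (q : CommutativeRing.Carrier R) where

  open Dilation R public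
  private module R = CommutativeRing R
  open R using (Carrier; _≈_; 0#; 1#)
  open Exp R.semiring public using (_^_; ^-homo-*; ^-assocʳ; ^-congˡ; ^-congʳ)
  open CommutativeRing commutativeRing
    using (_+_; _*_; refl; sym; trans; +-cong; +-congˡ; +-congʳ; *-cong; *-congˡ; *-congʳ; *-assoc;
      *-identityˡ; distribˡ)

  Q : Series
  Q = const q

  σ² : Series → Series
  σ² = σ (q ^ 2)

  τ : Series → Series
  τ f n = q ^ (n ℕ.* (n ℕ.∸ 1)) R.* f n

  τ-cong : ∀ {f g} → f ≋ g → τ f ≋ τ g
  τ-cong p .at n = R.*-congˡ (p .at n)

  τ-+ : ∀ f g → τ (f + g) ≋ τ f + τ g
  τ-+ f g .at n = R.distribˡ _ _ _

  τ-const* : ∀ r f → τ (const r * f) ≋ const r * τ f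
  τ-const* r f .at n = begin
    p R.* (const r * f) n  ≈⟨ R.*-congˡ (const⊛-at r f n) ⟩
    p R.* (r R.* f n)      ≈⟨ solve 3 (λ p r f → p :* (r :* f) := r :* (p :* f)) R.refl p r (f n) ⟩
    r R.* τ f n            ≈⟨ const⊛-at r (τ f) n ⟨
    (const r * τ f) n      ∎
    where
    open ≈R
    open RSolver
    p = q ^ (n ℕ.* (n ℕ.∸ 1))

  τ-σ : ∀ r f → τ (σ r f) ≋ σ r (τ f)
  τ-σ r f .at n = solve 3 (λ p r f → p :* (r :* f) := r :* (p :* f)) R.refl _ _ (f n)
    where open RSolver

  -- Since (n+1) n = 2n + n (n-1), each factor x in an equation for P becomes a further substitution
  -- of xq² for x in the equation for `τ P`. This is how the arguments xq⁴ and xq⁶ arise.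
  τ-X* : ∀ f → τ (X * f) ≋ X * σ² (τ f)
  τ-X* f = trans (τ-cong (X*-at f)) (trans (pointwise shifted) (sym (X*-at _)))
    where
    open ≈R
    exponent : ∀ n → suc n ℕ.* n ≡ 2 ℕ.* n ℕ.+ n ℕ.* (n ℕ.∸ 1)
    exponent zero    = ≡.refl
    exponent (suc n) = lemma n
      where
      lemma : ∀ n → (2 ℕ.+ n) ℕ.* (1 ℕ.+ n) ≡ 2 ℕ.* (1 ℕ.+ n) ℕ.+ (1 ℕ.+ n) ℕ.* n
      lemma = solve-∀
    shifted : ∀ n → τ (shift f) n ≈ shift (σ² (τ f)) n
    shifted zero    = R.zeroʳ _
    shifted (suc n) = begin
      q ^ (suc n ℕ.* n) R.* f n
        ≈⟨ R.*-congʳ (^-congʳ q (exponent n)) ⟩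
      q ^ (2 ℕ.* n ℕ.+ n ℕ.* (n ℕ.∸ 1)) R.* f n
        ≈⟨ R.*-congʳ (^-homo-* q (2 ℕ.* n) _) ⟩
      q ^ (2 ℕ.* n) R.* q ^ (n ℕ.* (n ℕ.∸ 1)) R.* f n
        ≈⟨ R.*-assoc _ _ _ ⟩
      q ^ (2 ℕ.* n) R.* τ f n
        ≈⟨ R.*-congʳ (^-assocʳ q 2 n) ⟨
      (q ^ 2) ^ n R.* τ f n ∎

  σ²-X* : ∀ f → σ² (X * f) ≋ Q ^ₛ 2 * X * σ² f
  σ²-X* f = trans (σ-* _ _ _) (*-congʳ (trans (σ-X _) (*-congʳ (const-^ q 2))))

  σ-Q^* : ∀ r n f → σ r (Q ^ₛ n * f) ≋ Q ^ₛ n * σ r f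
  σ-Q^* r n f = trans (σ-* _ _ _)
    (*-congʳ (trans (σ-cong (sym (const-^ q n))) (trans (σ-const _ _) (const-^ q n))))

  -- f₃ + x³q⁸ f₀(xq⁶) =
  --   f₂(xq²) + xq f₂(xq²) + xq² f₁(xq⁴) + x²q³ f₁(xq⁴) + x²q⁶ f₀(xq⁶)
  Recurrence : (f₃ f₂ f₁ f₀ : Series) → Set ℓ
  Recurrence f₃ f₂ f₁ f₀ =
    f₃ + Q ^ₛ 8 * (X * (X * (X * σ² (σ² (σ² f₀)))))
    ≋ σ² f₂ + Q * (X * σ² f₂) + Q ^ₛ 2 * (X * σ² (σ² f₁))
      + Q ^ₛ 3 * (X * (X * σ² (σ² f₁))) + Q ^ₛ 6 * (X * (X * σ² (σ² (σ² f₀))))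

  -- (1 - xq)(1 - x²q) f(x) = (1 + xq² + x²q⁴) f(xq²), without subtractions
  ProductRecurrence : Series → Set ℓ
  ProductRecurrence f =
    f + Q ^ₛ 2 * (X * (X * (X * f)))
    ≋ σ² f + Q ^ₛ 2 * (X * σ² f) + Q ^ₛ 4 * (X * (X * σ² f)) + Q * (X * f) + Q * (X * (X * f))

  module _ {P : Series} (P-eq : ProductRecurrence P) where

    private
      T = τ P
      open ≋R
      open SSolver

      τ-Q^* : ∀ n f → τ (Q ^ₛ n * f) ≋ Q ^ₛ n * τ f
      τ-Q^* n f = trans (τ-cong (*-congʳ (sym (const-^ q n))))
                    (trans (τ-const* (q ^ n) f) (*-congʳ (const-^ q n)))

      τ-X²* : ∀ f → τ (X * (X * f)) ≋ Q ^ₛ 2 * (X * (X * σ² (σ² (τ f))))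
      τ-X²* f = begin
        τ (X * (X * f))        ≈⟨ τ-X* _ ⟩
        X * σ² (τ (X * f))     ≈⟨ *-congˡ (σ-cong (τ-X* f)) ⟩
        X * σ² (X * σ² (τ f))  ≈⟨ *-congˡ (σ²-X* _) ⟩
        X * (Q ^ₛ 2 * X * σ² (σ² (τ f)))
          ≈⟨ solve 3 (λ x q f → x :* (q :* x :* f) := q :* (x :* (x :* f))) refl X (Q ^ₛ 2) _ ⟩
        Q ^ₛ 2 * (X * (X * σ² (σ² (τ f)))) ∎

      τ-X³* : ∀ f → τ (X * (X * (X * f))) ≋ Q ^ₛ 6 * (X * (X * (X * σ² (σ² (σ² (τ f))))))
      τ-X³* f = begin
        τ (X * (X * (X * f)))
          ≈⟨ τ-X²* (X * f) ⟩
        Q ^ₛ 2 * (X * (X * σ² (σ² (τ (X * f)))))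
          ≈⟨ *-congˡ (*-congˡ (*-congˡ (begin
               σ² (σ² (τ (X * f)))             ≈⟨ σ-cong (σ-cong (τ-X* f)) ⟩
               σ² (σ² (X * σ² (τ f)))          ≈⟨ σ-cong (σ²-X* _) ⟩
               σ² (Q ^ₛ 2 * X * g)             ≈⟨ σ-cong (*-assoc _ _ _) ⟩
               σ² (Q ^ₛ 2 * (X * g))           ≈⟨ σ-Q^* _ 2 _ ⟩
               Q ^ₛ 2 * σ² (X * g)             ≈⟨ *-congˡ (σ²-X* g) ⟩
               Q ^ₛ 2 * (Q ^ₛ 2 * X * σ² g)    ∎))) ⟩
        Q ^ₛ 2 * (X * (X * (Q ^ₛ 2 * (Q ^ₛ 2 * X * σ² g))))
          ≈⟨ solve 3 (λ x p f → p :* (x :* (x :* (p :* (p :* x :* f))))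
              := p :* (p :* p) :* (x :* (x :* (x :* f)))) refl X (Q ^ₛ 2) _ ⟩
        Q ^ₛ 2 * (Q ^ₛ 2 * Q ^ₛ 2) * (X * (X * (X * σ² g)))
          ≈⟨ *-congʳ (trans (Exp.^-homo-* S.semiring Q 2 4) (*-congˡ (Exp.^-homo-* S.semiring Q 2 2))) ⟨
        Q ^ₛ 6 * (X * (X * (X * σ² g))) ∎
        where g = σ² (σ² (τ f))

      merge : ∀ a b c n f → a ℕ.+ b ≡ c → n ≋ Q ^ₛ b * f → Q ^ₛ a * n ≋ Q ^ₛ c * f
      merge a b c n f eq p = begin
        Q ^ₛ a * n               ≈⟨ *-congˡ p ⟩
        Q ^ₛ a * (Q ^ₛ b * f)    ≈⟨ *-assoc _ _ _ ⟨
        Q ^ₛ a * Q ^ₛ b * f      ≈⟨ *-congʳ (Exp.^-homo-* S.semiring Q a b) ⟨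
        Q ^ₛ (a ℕ.+ b) * f       ≈⟨ *-congʳ (Exp.^-congʳ S.semiring Q eq) ⟩
        Q ^ₛ c * f               ∎

    -- Passing `τ` through x² and x³ produces q² and q⁶ along with two and three dilations; hence
    -- the exponents 3 = 1 + 2, 6 = 4 + 2 and 8 = 2 + 6 of `Recurrence`.
    τ-recurrence : Recurrence T T T T
    τ-recurrence = begin
      T + Q ^ₛ 8 * (X * (X * (X * σ² (σ² (σ² T)))))
        ≈⟨ +-congˡ (trans (τ-Q^* 2 _) (merge 2 6 8 _ _ ≡.refl (τ-X³* P))) ⟨
      T + τ (Q ^ₛ 2 * (X * (X * (X * P))))
        ≈⟨ τ-+ _ _ ⟨
      τ (P + Q ^ₛ 2 * (X * (X * (X * P))))
        ≈⟨ τ-cong P-eq ⟩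
      τ (σ² P + Q ^ₛ 2 * (X * σ² P) + Q ^ₛ 4 * (X * (X * σ² P)) + Q * (X * P) + Q * (X * (X * P)))
        ≈⟨ trans (τ-+ _ _)
            (+-cong (trans (τ-+ _ _) (+-cong (trans (τ-+ _ _) (+-cong (τ-+ _ _) refl)) refl)) refl) ⟩
      τ (σ² P) + τ (Q ^ₛ 2 * (X * σ² P)) + τ (Q ^ₛ 4 * (X * (X * σ² P))) + τ (Q * (X * P))
          + τ (Q * (X * (X * P)))
        ≈⟨ +-cong (+-cong (+-cong (+-cong (τ-σ _ P)
             (trans (τ-Q^* 2 _) (*-congˡ (trans (τ-X* _) (*-congˡ (σ-cong (τ-σ _ P)))))))
             (trans (τ-Q^* 4 _)
                 (merge 4 2 6 _ _ ≡.refl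
                     (trans (τ-X²* _) (*-congˡ (*-congˡ (*-congˡ (σ-cong (σ-cong (τ-σ _ P))))))))))
             (trans (τ-const* q _) (*-congˡ (τ-X* P))))
             (trans (τ-const* q _) (trans (*-congʳ (sym (S.*-identityʳ Q)))
                 (merge 1 2 3 _ _ ≡.refl (τ-X²* P)))) ⟩
      σ² T + Q ^ₛ 2 * (X * σ² (σ² T)) + Q ^ₛ 6 * (X * (X * σ² (σ² (σ² T)))) + Q * (X * σ² T)
          + Q ^ₛ 3 * (X * (X * σ² (σ² T)))
        ≈⟨ solve 5 (λ a b c d e → a :+ b :+ c :+ d :+ e := a :+ d :+ b :+ e :+ c) refl _ _ _ _ _ ⟩
      σ² T + Q * (X * σ² T) + Q ^ₛ 2 * (X * σ² (σ² T)) + Q ^ₛ 3 * (X * (X * σ² (σ² T)))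
          + Q ^ₛ 6 * (X * (X * σ² (σ² (σ² T)))) ∎

  -- In the application these are Euler's expansions of A = 1/(xq;q)_∞, B = 1/(x²q;q⁴)_∞ and D =
  -- (x³q⁶;q⁶)_∞; the recurrences of their coefficients replace the infinite products.
  module TripleProduct (a b d : Series)
    (a-suc : ∀ j → a (suc j) ≈ q ^ suc j R.* a (suc j) R.+ q R.* a j)
    (b-suc : ∀ j → b (suc j) ≈ (q ^ 4) ^ suc j R.* b (suc j) R.+ q R.* b j)
    (d-suc : ∀ j → d (suc j) R.+ (q ^ 6) ^ suc j R.* d j ≈ (q ^ 6) ^ suc j R.* d (suc j))
    where

    A B D P : Series
    A = strided 0 a 0
    B = strided 1 b 0
    D = strided 2 d 0
    P = A * B * D

    private
      open ≋R

      strided-scale-≋ : ∀ p r b → strided p (λ j → r R.* b j) 0 ≋ const r * strided p b 0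
      strided-scale-≋ p r b .at n = R.trans (strided-scale p r b 0 n) (R.sym (const⊛-at r _ n))

      σ-strided : ∀ p s r b → s ≈ r ^ suc p → strided p (σ s b) 0 ≋ σ r (strided p b 0)
      σ-strided p s r b eq .at n = R.trans (strided-cong p 0 n (λ j → R.*-congʳ (^-congˡ j eq)))
        (R.trans (R.sym (R.*-identityˡ _)) (R.sym (strided-σ p r b 0 n)))

      A₁ : Series
      A₁ = σ q A

      A-eq : A ≋ A₁ + Q * X * A
      A-eq = begin
        A ≈⟨ strided-recurrence 0 {v = σ q a} {w = λ j → q R.* a j} (R.sym (R.*-identityˡ _)) a-suc ⟩
        strided 0 (σ q a) 0 + X ^ₛ 1 * strided 0 (λ j → q R.* a j) 0
          ≈⟨ +-cong (σ-strided 0 q q a (R.sym (R.*-identityʳ q))) (*-congˡ (strided-scale-≋ 0 q a)) ⟩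
        A₁ + X ^ₛ 1 * (Q * A)
          ≈⟨ +-congˡ (solve 3 (λ x q a → x :^ 1 :* (q :* a) := q :* x :* a) refl X Q A) ⟩
        A₁ + Q * X * A ∎
        where open SSolver

      A₁-eq : A₁ ≋ σ² A + Q * Q * X * A₁
      A₁-eq = begin
        A₁                            ≈⟨ σ-cong A-eq ⟩
        σ q (A₁ + Q * X * A)          ≈⟨ trans (σ-+ _ _ _) (+-cong
              (trans (σ-∘ q q A) (σ-congˡ A (R.*-congˡ (R.sym (R.*-identityʳ q)))))
              (trans (σ-* _ _ _) (*-congʳ (trans (σ-* _ _ _) (*-cong (σ-const q q) (σ-X q)))))) ⟩
        σ² A + Q * (Q * X) * A₁       ≈⟨ +-congˡ (*-congʳ (*-assoc _ _ _)) ⟨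
        σ² A + Q * Q * X * A₁         ∎

      B-eq : B ≋ σ² B + Q * (X * X) * B
      B-eq = begin
        B ≈⟨ strided-recurrence 1 {v = σ (q ^ 4) b} {w = λ j →
            q R.* b j} (R.sym (R.*-identityˡ _)) b-suc ⟩
        strided 1 (σ (q ^ 4) b) 0 + X ^ₛ 2 * strided 1 (λ j → q R.* b j) 0
          ≈⟨ +-cong (σ-strided 1 _ (q ^ 2) b (R.sym (^-assocʳ q 2 2)))
              (*-congˡ (strided-scale-≋ 1 q b)) ⟩
        σ² B + X ^ₛ 2 * (Q * B)
          ≈⟨ +-congˡ (solve 3 (λ x q a → x :^ 2 :* (q :* a) := q :* (x :* x) :* a) refl X Q B) ⟩
        σ² B + Q * (X * X) * B ∎
        where open SSolver

      D-eq : D + Q * Q * X * (Q * Q * X) * (Q * Q * X) * σ² D ≋ σ² D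
      D-eq = begin
        D + Q * Q * X * (Q * Q * X) * (Q * Q * X) * σ² D
          ≈⟨ +-congˡ (solve 3 (λ x q d → q :* q :* x :* (q :* q :* x) :* (q :* q :* x) :* d
              := x :^ 3 :* (q :^ 6 :* d)) refl X Q _) ⟩
        D + X ^ₛ 3 * (Q ^ₛ 6 * σ² D)
          ≈⟨ +-congˡ (*-congˡ (*-congʳ (const-^ q 6))) ⟨
        D + X ^ₛ 3 * (const (q ^ 6) * σ² D)
          ≈⟨ +-congˡ (*-congˡ (trans (pointwise λ n → strided-cong 2 0 n λ j → R.*-assoc _ _ _)
               (trans (strided-scale-≋ 2 (q ^ 6) (σ (q ^ 6) d)) (*-congˡ σD)))) ⟨
        D + X ^ₛ 3 * strided 2 (λ j → (q ^ 6) ^ suc j R.* d j) 0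
          ≈⟨ +-congʳ (pointwise λ n → strided-cong 2 0 n λ j → R.sym (R.+-identityʳ (d j))) ⟩
        strided 2 (λ j → d j R.+ 0#) 0 + X ^ₛ 3 * strided 2 (λ j → (q ^ 6) ^ suc j R.* d j) 0
          -- In contrast to A and B, the dilated series is the one expressed by the other: D(xq²) =
          -- D + x³q⁶ D(xq²).
          ≈⟨ strided-recurrence 2 {u = σ (q ^ 6) d} {v = λ j → d j R.+ 0#}
               (R.trans (R.*-identityˡ _) (R.sym (R.+-identityʳ _)))
               (λ j → R.trans (R.sym (d-suc j)) (R.+-congʳ (R.sym (R.+-identityʳ _)))) ⟨
        strided 2 (σ (q ^ 6) d) 0
          ≈⟨ σD ⟩
        σ² D ∎
        where
        open SSolver
        σD : strided 2 (σ (q ^ 6) d) 0 ≋ σ² D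
        σD = σ-strided 2 _ (q ^ 2) d (R.sym (^-assocʳ q 2 3))

    P-eq : ProductRecurrence P
    P-eq = begin
      P + Q ^ₛ 2 * (X * (X * (X * P)))
        ≈⟨ solve 3 (λ x q p → p :+ q :^ 2 :* (x :* (x :* (x :* p))) := p
            :+ (q :* x) :* (q :* (x :* x)) :* p) refl X Q P ⟩
      P + Q * X * (Q * (X * X)) * P
        ≈⟨ product-recurrence commutativeRing A-eq A₁-eq B-eq D-eq ⟩
      (S.1# + y + y * y) * (σ² A * σ² B * σ² D) + Q * X * P + Q * (X * X) * P
        ≈⟨ +-congʳ (+-congʳ (*-congˡ (trans (σ-* _ _ _) (*-congʳ (σ-* _ _ _))))) ⟨
      (S.1# + y + y * y) * σ² P + Q * X * P + Q * (X * X) * P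
        ≈⟨ solve 4 (λ x q p s → (con 1 :+ q :* q :* x :+ q :* q :* x :* (q :* q :* x)) :* s
            :+ q :* x :* p :+ q :* (x :* x) :* p
             := s :+ q :^ 2 :* (x :* s) :+ q :^ 4 :* (x :* (x :* s)) :+ q :* (x :* p)
                 :+ q :* (x :* (x :* p))) refl X Q P (σ² P) ⟩
      σ² P + Q ^ₛ 2 * (X * σ² P) + Q ^ₛ 4 * (X * (X * σ² P)) + Q * (X * P) + Q * (X * (X * P)) ∎
      where
      open SSolver
      y = Q * Q * X

    recurrence : Recurrence (τ P) (τ P) (τ P) (τ P)
    recurrence = τ-recurrence P-eq

  -- The generating functions of the lists free, afterOdd, afterEven and blocked
  -- of the module Partitions, with b = 0.
  𝐅 𝐆 𝐇 𝐊 : ℕ → Series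
  𝐅 zero    = S.1#
  𝐅 (suc M) = 𝐆 (suc M) + Q ^ₛ 3 * (X * (X * σ² (𝐊 M)))
  𝐆 zero    = S.1#
  𝐆 (suc M) = σ² (𝐅 M) + Q * (X * σ² (𝐆 M)) + Q ^ₛ 2 * (X * σ² (𝐇 M))
  𝐇 zero    = S.1#
  𝐇 (suc M) = σ² (𝐅 M) + Q ^ₛ 2 * (X * σ² (𝐊 M))
  𝐊 zero    = S.1#
  𝐊 (suc M) = σ² (𝐅 M)

  -- `𝐊` and `𝐇` are substituted away, while `𝐆` is completed to `𝐅`. They differ by the full first
  -- block, which after dilation is q⁷x² times `W`; the term `V` added on the left supplies xq times
  -- this. It is the source of the minus sign in the equation for F.
  𝐅-recurrence : ∀ M → Recurrence (𝐅 (3 ℕ.+ M)) (𝐅 (2 ℕ.+ M)) (𝐅 (1 ℕ.+ M)) (𝐅 M)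
  𝐅-recurrence M = begin
    σ² F₂ + Q * (X * σ² G₂) + Q ^ₛ 2 * (X * σ² (σ² F₁ + Q ^ₛ 2 * (X * σ² (σ² F₀))))
        + Q ^ₛ 3 * (X * (X * σ² (σ² F₁))) + V
      ≈⟨ +-congʳ (+-congʳ
          (+-congˡ (*-congˡ (*-congˡ (trans (σ-+ _ _ _) (+-congˡ (σ²-Q²x (σ² (σ² F₀))))))))) ⟩
    σ² F₂ + Q * (X * σ² G₂) + Q ^ₛ 2 * (X * (σ² (σ² F₁) + Q ^ₛ 4 * (X * W)))
        + Q ^ₛ 3 * (X * (X * σ² (σ² F₁))) + V
      ≈⟨ solve 6 (λ q x f₂ g₂ f₁ w →
           f₂ :+ q :* (x :* g₂) :+ q :^ 2 :* (x :* (f₁ :+ q :^ 4 :* (x :* w)))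
               :+ q :^ 3 :* (x :* (x :* f₁)) :+ q :^ 8 :* (x :* (x :* (x :* w)))
           := f₂ :+ q :* (x :* (g₂ :+ q :^ 7 :* (x :* (x :* w)))) :+ q :^ 2 :* (x :* f₁)
               :+ q :^ 3 :* (x :* (x :* f₁)) :+ q :^ 6 :* (x :* (x :* w)))
           refl Q X (σ² F₂) (σ² G₂) (σ² (σ² F₁)) W ⟩
    σ² F₂ + Q * (X * (σ² G₂ + Q ^ₛ 7 * (X * (X * W)))) + Q ^ₛ 2 * (X * σ² (σ² F₁))
        + Q ^ₛ 3 * (X * (X * σ² (σ² F₁))) + Q ^ₛ 6 * (X * (X * W))
      ≈⟨ +-congʳ (+-congʳ
          (+-congʳ (+-congˡ
              (*-congˡ (*-congˡ (trans (σ-+ _ _ _) (+-congˡ (σ²-Q³x² (σ² (σ² F₀))))))))))  ⟨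
    σ² F₂ + Q * (X * σ² F₂) + Q ^ₛ 2 * (X * σ² (σ² F₁)) + Q ^ₛ 3 * (X * (X * σ² (σ² F₁)))
        + Q ^ₛ 6 * (X * (X * W)) ∎
    where
    open ≋R
    open SSolver
    F₂ = 𝐅 (2 ℕ.+ M)
    F₁ = 𝐅 (1 ℕ.+ M)
    F₀ = 𝐅 M
    G₂ = 𝐆 (2 ℕ.+ M)
    W = σ² (σ² (σ² F₀))
    V = Q ^ₛ 8 * (X * (X * (X * W)))
    σ²-Q²x : ∀ f → σ² (Q ^ₛ 2 * (X * f)) ≋ Q ^ₛ 4 * (X * σ² f)
    σ²-Q²x f = trans (σ-Q^* _ 2 _) (trans (*-congˡ (σ²-X* f))
      (solve 3 (λ q x f → q :^ 2 :* (q :^ 2 :* x :* f) := q :^ 4 :* (x :* f)) refl Q X _))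
    σ²-Q³x² : ∀ f → σ² (Q ^ₛ 3 * (X * (X * f))) ≋ Q ^ₛ 7 * (X * (X * σ² f))
    σ²-Q³x² f = trans (σ-Q^* _ 3 _) (trans (*-congˡ (trans (σ²-X* _) (*-congˡ (σ²-X* f))))
      (solve 3 (λ q x f → q :^ 3 :* (q :^ 2 :* x :* (q :^ 2 :* x :* f)) := q :^ 7 :* (x :* (x :* f)))
          refl Q X _))

  σ-σ² : ∀ b f → σ (q ^ b) (σ² f) ≋ σ (q ^ (2 ℕ.+ b)) f
  σ-σ² b f = trans (σ-∘ _ _ f) (σ-congˡ f (R.trans (R.sym (^-homo-* q b 2)) (^-congʳ q (ℕ.+-comm b 2))))

  σ-X* : ∀ b f → σ (q ^ b) (X * f) ≋ const (q ^ b) * (X * σ (q ^ b) f)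
  σ-X* b f = trans (σ-* _ X f) (trans (*-congʳ (σ-X _)) (*-assoc _ _ _))

  const-^-+ : ∀ n b → const (q ^ (n ℕ.+ b)) ≋ Q ^ₛ n * const (q ^ b)
  const-^-+ n b = trans (const-cong (^-homo-* q n b)) (trans (const-* _ _) (*-congʳ (const-^ q n)))

  σ-Q^X* : ∀ n b f → σ (q ^ b) (Q ^ₛ n * (X * f)) ≋ const (q ^ (n ℕ.+ b)) * (X * σ (q ^ b) f)
  σ-Q^X* n b f = begin
    σ (q ^ b) (Q ^ₛ n * (X * f))
      ≈⟨ trans (σ-Q^* _ n _) (*-congˡ (σ-X* b f)) ⟩
    Q ^ₛ n * (const (q ^ b) * (X * σ (q ^ b) f))
      ≈⟨ trans (*-congʳ (const-^-+ n b)) (*-assoc _ _ _) ⟨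
    const (q ^ (n ℕ.+ b)) * (X * σ (q ^ b) f) ∎
    where open ≋R

  σ-QX* : ∀ b f → σ (q ^ b) (Q * (X * σ² f)) ≋ const (q ^ (1 ℕ.+ b)) * (X * σ (q ^ (2 ℕ.+ b)) f)
  σ-QX* b f = trans (σ-cong (*-congʳ (sym (S.*-identityʳ Q))))
      (trans (σ-Q^X* 1 b _) (*-congˡ (*-congˡ (σ-σ² b f))))

  σ-Q²X* : ∀ b f → σ (q ^ b) (Q ^ₛ 2 * (X * σ² f)) ≋ const (q ^ (2 ℕ.+ b)) * (X * σ (q ^ (2 ℕ.+ b)) f)
  σ-Q²X* b f = trans (σ-Q^X* 2 b _) (*-congˡ (*-congˡ (σ-σ² b f)))

  σ-Q³X²* : ∀ b f → σ (q ^ b) (Q ^ₛ 3 * (X * (X * σ² f))) ≋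
    const (q ^ (1 ℕ.+ b)) * (X * (const (q ^ (2 ℕ.+ b)) * (X * σ (q ^ (2 ℕ.+ b)) f)))
  σ-Q³X²* b f = begin
    σ (q ^ b) (Q ^ₛ 3 * (X * (X * σ² f)))
      ≈⟨ trans (σ-Q^X* 3 b _)
          (*-cong (const-^-+ 3 b) (*-congˡ (trans (σ-X* b _) (*-congˡ (*-congˡ (σ-σ² b f)))))) ⟩
    Q ^ₛ 3 * p * (X * (p * (X * g)))
      ≈⟨ solve 4 (λ q p x g → q :^ 3 :* p :* (x :* (p :* (x :* g)))
          := q :^ 1 :* p :* (x :* (q :^ 2 :* p :* (x :* g)))) refl Q p X g ⟩
    Q ^ₛ 1 * p * (X * (Q ^ₛ 2 * p * (X * g)))
      ≈⟨ *-cong (const-^-+ 1 b) (*-congˡ (*-congʳ (const-^-+ 2 b))) ⟨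
    const (q ^ (1 ℕ.+ b)) * (X * (const (q ^ (2 ℕ.+ b)) * (X * g))) ∎
    where
    open ≋R
    open SSolver using (solve; _:*_; _:^_; _:=_)
    p g : Series
    p = const (q ^ b)
    g = σ (q ^ (2 ℕ.+ b)) f

  *X*-at-0 : ∀ g f → (g * (X * f)) 0 ≈ 0#
  *X*-at-0 g f = R.trans (R.*-congˡ (X*-at f .at 0)) (R.zeroʳ _)

  +-*X*-at-0 : ∀ h g f → (h + g * (X * f)) 0 ≈ h 0
  +-*X*-at-0 h g f = R.trans (R.+-congˡ (*X*-at-0 g f)) (R.+-identityʳ _)

  𝐅-at-0 : ∀ M → 𝐅 M 0 ≈ 1#
  𝐅-at-0 zero    = R.refl
  𝐅-at-0 (suc M) = R.trans (+-*X*-at-0 (𝐆 (suc M)) (Q ^ₛ 3) (X * σ² (𝐊 M)))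
    (R.trans (+-*X*-at-0 (σ² (𝐅 M) + Q * (X * σ² (𝐆 M))) (Q ^ₛ 2) (σ² (𝐇 M)))
      (R.trans (+-*X*-at-0 (σ² (𝐅 M)) Q (σ² (𝐆 M))) (R.trans (R.*-identityˡ _) (𝐅-at-0 M))))

-- Unconditional sums

-- Induction on `L`: its head is moved to the front of `L′` by a permutation and split off there.
-- When `L` is exhausted, only vanishing terms are left.
sum-superset : ∀ {I : Set} (g : I → ℤ) (L L′ : List I) → Unique L → Unique L′ → L ⊆ L′ →
  (∀ {i} → i ∈ L′ → i ∈ L ⊎ g i ≡ 0ℤ) → foldr ℤ._+_ 0ℤ (map g L′) ≡ foldr ℤ._+_ 0ℤ (map g L)
sum-superset g [] L′ _ _ _ vanish = go L′ vanish
  where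
  go : ∀ L′ → (∀ {i} → i ∈ L′ → i ∈ [] ⊎ g i ≡ 0ℤ) → foldr ℤ._+_ 0ℤ (map g L′) ≡ 0ℤ
  go []       _ = ≡.refl
  go (i ∷ L′) v with v (here ≡.refl)
  ... | inj₂ gi≡0 = ≡.cong₂ ℤ._+_ gi≡0 (go L′ (v ∘ there))
sum-superset g (x ∷ L) L′ (x∉L ∷ uL) uL′ L⊆L′ vanish
  with ys , zs , ≡.refl ← ∈-∃++ (L⊆L′ (here ≡.refl))
  with x∉W ∷ uW ← ↭ₛ.Unique-resp-↭ (≡.setoid _) (↭⇒↭ₛ (↭.shift x ys zs)) uL′
  = ≡.trans
      (↭ₛ.foldr-commMonoid (≡.setoid ℤ) ℤ.+-0-isCommutativeMonoid (↭⇒↭ₛ (↭.map⁺ g (↭.shift x ys zs))))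
      (≡.cong (λ s → g x ℤ.+ s) (sum-superset g L (ys ++ zs) uL uW L⊆W vanishW))
  where
  L⊆W : L ⊆ ys ++ zs
  L⊆W i∈L with ↭.∈-resp-↭ (↭.shift x ys zs) (L⊆L′ (there i∈L))
  ... | here ≡.refl = contradiction i∈L (All.All¬⇒¬Any x∉L)
  ... | there i∈W   = i∈W
  vanishW : ∀ {i} → i ∈ ys ++ zs → i ∈ L ⊎ g i ≡ 0ℤ
  vanishW i∈W with vanish (↭.∈-resp-↭ (↭-sym (↭.shift x ys zs)) (there i∈W))
  ... | inj₁ (here ≡.refl) = contradiction i∈W (All.All¬⇒¬Any x∉W)
  ... | inj₁ (there i∈L)   = inj₁ i∈L
  ... | inj₂ gi≡0          = inj₂ gi≡0

-- Both sides of each identity are summed through this criterion, the finite list being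
-- `box (suc m)` for the triple sum and `free e (3 + n)` for the partitions.
hasSum : ∀ {I : Set} {P : I → Set} {f : I → XQSeries} {S : XQSeries} →
  (∀ m n → ∃ λ L → Unique L × All P L × (∀ {i} → P i → i ∈ L ⊎ f i m n ≡ 0ℤ) × ∑coeff f L m n ≡ S m n) →
  HasSum P f S
hasSum {f = f} finite m n with L , uL , allL , complete , eq ← finite m n =
  L , uL , allL , λ L′ uL′ allL′ L⊆L′ →
    ≡.trans (sum-superset (λ i → f i m n) L L′ uL uL′ L⊆L′ (complete ∘ All.lookup allL′)) eq

-- The partitions

module Partitions where

  open import Data.Nat.Base using (_+_; _*_; _≤_; _<_)
  open import Data.Nat.Properties
  open ≡ using (refl; sym; trans; cong; subst)
  open 𝒫

  𝒫-[] : 𝒫 []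
  𝒫-[] = record
    { isPartition = [] , [] ; noRepeats = [] ; noEvenStep = []
    ; avoids₁ = λ { j (here ()) } ; avoids₂ = λ { j (here ()) } ; avoids₃ = λ { j (here ()) } }

  𝒫-tail : ∀ {a π} → 𝒫 (a ∷ π) → 𝒫 π
  𝒫-tail p = record
    { isPartition = All.tail (proj₁ (isPartition p)) , Linked.tail (proj₂ (isPartition p))
    ; noRepeats   = AllPairs.tail (noRepeats p)
    ; noEvenStep  = Linked.tail (noEvenStep p)
    ; avoids₁     = λ j → avoids₁ p j ∘ there
    ; avoids₂     = λ j → avoids₂ p j ∘ there
    ; avoids₃     = λ j → avoids₃ p j ∘ there }

  𝒫-increasing : ∀ {a π} → 𝒫 (a ∷ π) → All (a <_) π
  𝒫-increasing p = All.zipWith (λ (a≤b , a≢b) → ≤∧≢⇒< a≤b a≢b)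
    (AllPairs.head (Linked⇒AllPairs ≤-trans (proj₂ (isPartition p))) , AllPairs.head (noRepeats p))

  even-+2 : ∀ {b} → 2 ∣ b → 2 ∣ 2 + b
  even-+2 = ∣m∣n⇒∣m+n ∣-refl

  odd-1+even : ∀ {b} → 2 ∣ b → ¬ (2 ∣ 1 + b)
  odd-1+even {b} 2∣b 2∣1+b = contradiction (∣⇒≤ (∣m+n∣m⇒∣n (subst (2 ∣_) (+-comm 1 b) 2∣1+b) 2∣b))
      λ { (s≤s ()) }

  -- Carries the patterns, which live over ℤ, back to differences of parts in ℕ; `z` is the 2j of a
  -- pattern.
  gap : ∀ z m d {a b} → z ℤ.+ + m ≡ + a → z ℤ.+ + (m + d) ≡ + b → b ≡ d + a
  gap z m d {a} {b} eq₁ eq₂ = ℤ.+-injective (trans (sym eq₂)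
    (trans (sym (ℤ.+-assoc z (+ m) (+ d))) (trans (cong (ℤ._+ + d) eq₁) (ℤ.+-comm (+ a) (+ d)))))

  double-even : ∀ j {a} → + 2 ℤ.* j ≡ + a → 2 ∣ a
  double-even j eq = divides ℤ.∣ j ∣
    (trans (sym (cong ℤ.∣_∣ eq)) (trans (ℤ.abs-* (+ 2) j) (*-comm 2 ℤ.∣ j ∣)))

  -- A forbidden configuration that is new in `a ∷ π` begins at `a`. The last two conditions carry
  -- no parity: for even `a` they follow from the absence of even steps, from `a` to 1 + a or from 2
  -- + a to 3 + a.
  𝒫-∷ : ∀ {a π} → 1 ≤ a → 𝒫 π → All (a <_) π →
    (∀ {b ρ} → π ≡ b ∷ ρ → 2 ∣ a → b ≢ 1 + a) →
    (∀ {b c ρ} → π ≡ b ∷ c ∷ ρ → 2 ∣ a → b ≡ 2 + a → c ≢ 4 + a) →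
    (∀ {b c ρ} → π ≡ b ∷ c ∷ ρ → b ≡ 1 + a → c ≢ 3 + a) →
    (∀ {b c ρ} → π ≡ b ∷ c ∷ ρ → b ≡ 2 + a → c ≢ 3 + a) →
    𝒫 (a ∷ π)
  𝒫-∷ {a} {π} 1≤a p a<π step c₁ c₂ c₃ = record
    { isPartition = 1≤a ∷ proj₁ (isPartition p) , linked π (proj₂ (isPartition p)) a<π
    ; noRepeats   = All.map <⇒≢ a<π ∷ noRepeats p
    ; noEvenStep  = linked′ π (noEvenStep p) step
    ; avoids₁ = λ { j (here (e₁ ∷ e₂ ∷ e₃ ∷ _)) →
                      let e₀ = trans (ℤ.+-identityʳ _) e₁ in
                      c₁ refl (double-even j e₁) (gap (+ 2 ℤ.* j) 0 2 e₀ e₂) (gap (+ 2 ℤ.* j) 0 4 e₀ e₃)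
                  ; j (there i) → avoids₁ p j i }
    ; avoids₂ = λ { j (here (e₁ ∷ e₂ ∷ e₃ ∷ _)) →
        c₂ refl (gap (+ 2 ℤ.* j) 1 1 e₁ e₂) (gap (+ 2 ℤ.* j) 1 3 e₁ e₃)
                  ; j (there i) → avoids₂ p j i }
    ; avoids₃ = λ { j (here (e₁ ∷ e₂ ∷ e₃ ∷ _)) →
        c₃ refl (gap (+ 2 ℤ.* j) 1 2 e₁ e₂) (gap (+ 2 ℤ.* j) 1 3 e₁ e₃)
                  ; j (there i) → avoids₃ p j i } }
    where
    linked : ∀ π → Linked _≤_ π → All (a <_) π → Linked _≤_ (a ∷ π)
    linked []      _ _         = [-]
    linked (b ∷ π) l (a<b ∷ _) = <⇒≤ a<b ∷ l
    linked′ : ∀ π → Linked _ π → (∀ {b ρ} → π ≡ b ∷ ρ → 2 ∣ a → b ≢ 1 + a) → Linked _ (a ∷ π)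
    linked′ []      _ _ = [-]
    linked′ (b ∷ π) l s = (λ (2∣a , b≡a+1) → s refl 2∣a (trans b≡a+1 (+-comm a 1))) ∷ l

  -- Every forbidden configuration beginning at `a` has second entry at most 2 + a.
  𝒫-∷-far : ∀ {a π} → 1 ≤ a → All (2 + a <_) π → 𝒫 π → 𝒫 (a ∷ π)
  𝒫-∷-far {a} 1≤a far p = 𝒫-∷ 1≤a p (All.map (<-trans (m<n+m a z<s)) far)
    (λ { refl _ refl → contradiction (All.head far) (<⇒≱ (n≤1+n _)) })
    (λ { refl _ refl _ → contradiction (All.head far) (<-irrefl refl) })
    (λ { refl refl _ → contradiction (All.head far) (<⇒≱ (n≤1+n _)) })
    (λ { refl refl _ → contradiction (All.head far) (<-irrefl refl) })

  -- A forbidden triple beginning at `a` has third entry 4 + a if `a` is even and 3 + a if it is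
  -- odd, so it is enough to keep `ρ` above that.
  𝒫-∷-near : ∀ {a b ρ} → 1 ≤ a → a < b → (2 ∣ a → b ≢ 1 + a × All (4 + a <_) ρ) →
    All (3 + a <_) ρ → 𝒫 (b ∷ ρ) → 𝒫 (a ∷ b ∷ ρ)
  𝒫-∷-near 1≤a a<b even far p = 𝒫-∷ 1≤a p (a<b ∷ All.map (<-trans a<b) (𝒫-increasing p))
    (λ { refl 2∣a → proj₁ (even 2∣a) })
    (λ { refl 2∣a _ refl → contradiction (All.head (proj₂ (even 2∣a))) (<-irrefl refl) })
    (λ { refl _ refl → contradiction (All.head far) (<-irrefl refl) })
    (λ { refl _ refl → contradiction (All.head far) (<-irrefl refl) })

  module _ {b : ℕ} (2∣b : 2 ∣ b) where

    private
      j : ℤ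
      j = + _∣_.quotient 2∣b

      2j+ : ∀ d → + 2 ℤ.* j ℤ.+ + d ≡ + (d + b)
      2j+ d = trans (cong (ℤ._+ + d) 2j) (ℤ.+-comm (+ b) (+ d))
        where
        2j : + 2 ℤ.* j ≡ + b
        2j = trans (sym (ℤ.pos-* 2 (_∣_.quotient 2∣b)))
            (cong +_ (trans (*-comm 2 (_∣_.quotient 2∣b)) (sym (_∣_.equality 2∣b))))

    ¬𝒫-step : ∀ {ρ} → ¬ 𝒫 (b ∷ 1 + b ∷ ρ)
    ¬𝒫-step p with ok ∷ _ ← noEvenStep p = ok (2∣b , +-comm 1 b)

    ¬𝒫-024 : ∀ {ρ} → ¬ 𝒫 (b ∷ 2 + b ∷ 4 + b ∷ ρ)
    ¬𝒫-024 p = avoids₁ p j (here (trans (sym (ℤ.+-identityʳ _)) (2j+ 0) ∷ 2j+ 2 ∷ 2j+ 4 ∷ []))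

    ¬𝒫-124 : ∀ {ρ} → ¬ 𝒫 (1 + b ∷ 2 + b ∷ 4 + b ∷ ρ)
    ¬𝒫-124 p = avoids₂ p j (here (2j+ 1 ∷ 2j+ 2 ∷ 2j+ 4 ∷ []))

    ¬𝒫-134 : ∀ {ρ} → ¬ 𝒫 (1 + b ∷ 3 + b ∷ 4 + b ∷ ρ)
    ¬𝒫-134 p = avoids₃ p j (here (2j+ 1 ∷ 2j+ 3 ∷ 2j+ 4 ∷ []))

  -- The parts > b, cut into M blocks {b+1, b+2}, {b+3, b+4}, …; free b M lists
  -- the elements of 𝒫 with parts in these blocks, and the other functions list
  -- the admissible continuations of a partition whose preceding block is {b-1},
  -- resp. {b} after a block without b-2, resp. contains b and forces the next
  -- block to be empty.
  free afterOdd afterEven blocked : ℕ → ℕ → List (List ℕ)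
  free b zero    = [ [] ]
  free b (suc M) = ((free (2 + b) M ++ map (1 + b ∷_) (afterOdd (2 + b) M))
    ++ map (2 + b ∷_) (afterEven (2 + b) M))
    ++ map (λ π → 1 + b ∷ 2 + b ∷ π) (blocked (2 + b) M)
  afterOdd b zero    = [ [] ]
  afterOdd b (suc M) = (free (2 + b) M ++ map (1 + b ∷_) (afterOdd (2 + b) M))
    ++ map (2 + b ∷_) (afterEven (2 + b) M)
  afterEven b zero    = [ [] ]
  afterEven b (suc M) = free (2 + b) M ++ map (2 + b ∷_) (blocked (2 + b) M)
  blocked b zero    = [ [] ]
  blocked b (suc M) = free (2 + b) M

  +2< : ∀ {b π} → All (2 + b <_) π → All (b <_) π
  +2< {b} = All.map (<-trans (m<n+m b z<s))

  +1< : ∀ {b π} → All (1 + b <_) π → All (b <_) π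
  +1< = All.map (<-trans (n<1+n _))

  -- The block lists enumerate 𝒫 without repetition

  free-> : ∀ b M → All (All (b <_)) (free b M)
  afterOdd-> : ∀ b M → All (All (b <_)) (afterOdd b M)
  afterEven-> : ∀ b M → All (All (b <_)) (afterEven b M)
  blocked-> : ∀ b M → All (All (2 + b <_)) (blocked b M)
  free-> b zero    = [] ∷ []
  free-> b (suc M) = All.++⁺ (afterOdd-> b (suc M))
    (All.map⁺ (All.map (λ l → ≤-refl ∷ s≤s (n≤1+n b) ∷ +2< (+2< l)) (blocked-> (2 + b) M)))
  afterOdd-> b zero    = [] ∷ []
  afterOdd-> b (suc M) = All.++⁺ (All.++⁺ (All.map +2< (free-> (2 + b) M))
    (All.map⁺ (All.map (λ l → ≤-refl ∷ +2< l) (afterOdd-> (2 + b) M))))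
    (All.map⁺ (All.map (λ l → s≤s (n≤1+n b) ∷ +2< l) (afterEven-> (2 + b) M)))
  afterEven-> b zero    = [] ∷ []
  afterEven-> b (suc M) = All.++⁺ (All.map +2< (free-> (2 + b) M))
    (All.map⁺ (All.map (λ l → s≤s (n≤1+n b) ∷ +2< (+2< l)) (blocked-> (2 + b) M)))
  blocked-> b zero    = [] ∷ []
  blocked-> b (suc M) = free-> (2 + b) M

  disjoint : ∀ {A : Set} {P : A → Set} {xs ys : List A} → All (λ x → ¬ P x) xs → All P ys →
      Disjoint xs ys
  disjoint ¬P P (x∈xs , x∈ys) = All.lookup ¬P x∈xs (All.lookup P x∈ys)

  >⇒∉ : ∀ {a π} → All (a <_) π → a ∉ π
  >⇒∉ a<π a∈π = <-irrefl refl (All.lookup a<π a∈π)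

  -- The pieces of a list differ in which of 1 + b and 2 + b occur, since all tails have parts above
  -- 2 + b.
  free-unique : ∀ b M → Unique (free b M)
  afterOdd-unique : ∀ b M → Unique (afterOdd b M)
  afterEven-unique : ∀ b M → Unique (afterEven b M)
  blocked-unique : ∀ b M → Unique (blocked b M)
  free-unique b zero    = [] ∷ []
  free-unique b (suc M) = Unique.++⁺ (afterOdd-unique b (suc M))
    (Unique.map⁺ (∷-injectiveʳ ∘ ∷-injectiveʳ) (blocked-unique (2 + b) M))
    (disjoint {P = λ π → 1 + b ∈ π × 2 + b ∈ π}
      (All.++⁺ (All.++⁺
        (All.map (λ l (i , _) → >⇒∉ (+1< l) i) (free-> (2 + b) M))
        (All.map⁺ (All.map (λ { l (_ , Any.there i) → >⇒∉ l i ; l (_ , Any.here e) → 1+n≢n e })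
            (afterOdd-> (2 + b) M))))
        (All.map⁺ (All.map (λ { l (Any.there i , _) → >⇒∉ (+1< l) i ; l (Any.here e , _) →
            1+n≢n (sym e) }) (afterEven-> (2 + b) M))))
      (All.map⁺ (All.universal (λ _ → Any.here refl , Any.there (Any.here refl)) _)))
  afterOdd-unique b zero    = [] ∷ []
  afterOdd-unique b (suc M) = Unique.++⁺
    (Unique.++⁺ (free-unique (2 + b) M) (Unique.map⁺ ∷-injectiveʳ (afterOdd-unique (2 + b) M))
      (disjoint {P = 1 + b ∈_} (All.map (>⇒∉ ∘ +1<) (free-> (2 + b) M))
          (All.map⁺ (All.universal (λ _ → Any.here refl) _))))
    (Unique.map⁺ ∷-injectiveʳ (afterEven-unique (2 + b) M))
    (disjoint {P = 2 + b ∈_}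
      (All.++⁺ (All.map >⇒∉ (free-> (2 + b) M))
        (All.map⁺ (All.map (λ { l (Any.there i) → >⇒∉ l i ; l (Any.here e) → 1+n≢n e }) (afterOdd-> (2
            + b) M))))
      (All.map⁺ (All.universal (λ _ → Any.here refl) _)))
  afterEven-unique b zero    = [] ∷ []
  afterEven-unique b (suc M) = Unique.++⁺ (free-unique (2 + b) M)
    (Unique.map⁺ ∷-injectiveʳ (blocked-unique (2 + b) M))
    (disjoint {P = 2 + b ∈_} (All.map >⇒∉ (free-> (2 + b) M))
        (All.map⁺ (All.universal (λ _ → Any.here refl) _)))
  blocked-unique b zero    = [] ∷ []
  blocked-unique b (suc M) = free-unique (2 + b) M

  free-sound : ∀ b M → 2 ∣ b → All 𝒫 (free b M)
  -- The part that causes the state is included, because the restrictions concern its relation to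
  -- the continuation. For `blocked` the gap left by the empty block takes over this role.
  afterOdd-sound : ∀ b M → 2 ∣ b → All (λ π → 𝒫 (1 + b ∷ π)) (afterOdd (2 + b) M)
  afterEven-sound : ∀ b M → 2 ∣ b → All (λ π → 𝒫 (2 + b ∷ π)) (afterEven (2 + b) M)
  blocked-sound : ∀ b M → 2 ∣ b → All 𝒫 (blocked b M)
  free-sound b zero    2∣b = 𝒫-[] ∷ []
  free-sound b (suc M) 2∣b = All.++⁺ (All.++⁺ (All.++⁺
    (free-sound (2 + b) M (even-+2 2∣b))
    (All.map⁺ (afterOdd-sound b M 2∣b)))
    (All.map⁺ (afterEven-sound b M 2∣b)))
    (All.map⁺ (All.zipWith
      (λ (p , l) → 𝒫-∷-near z<s ≤-refl (λ 2∣a → contradiction 2∣a (odd-1+even 2∣b)) l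
                     (𝒫-∷-far z<s l p))
      (blocked-sound (2 + b) M (even-+2 2∣b) , blocked-> (2 + b) M)))
  afterOdd-sound b zero    2∣b = 𝒫-∷-far z<s [] 𝒫-[] ∷ []
  afterOdd-sound b (suc M) 2∣b = All.++⁺ (All.++⁺
    (All.zipWith (λ (p , l) → 𝒫-∷-far z<s (+1< l) p) (free-sound (4 + b) M 2∣4+b , free-> (4 + b) M))
    (All.map⁺ (All.zipWith (λ (p , l) → 𝒫-∷-near z<s (n≤1+n _) (λ 2∣a →
        contradiction 2∣a (odd-1+even 2∣b)) l p)
      (afterOdd-sound (2 + b) M (even-+2 2∣b) , afterOdd-> (4 + b) M))))
    (All.map⁺ (All.zipWith (λ (p , l) → 𝒫-∷-far z<s (≤-refl ∷ +1< l) p)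
      (afterEven-sound (2 + b) M (even-+2 2∣b) , afterEven-> (4 + b) M)))
    where
    2∣4+b = even-+2 (even-+2 2∣b)
  afterEven-sound b zero    2∣b = 𝒫-∷-far z<s [] 𝒫-[] ∷ []
  afterEven-sound b (suc M) 2∣b = All.++⁺
    (All.zipWith (λ (p , l) → 𝒫-∷-far z<s l p) (free-sound (4 + b) M 2∣4+b , free-> (4 + b) M))
    (All.map⁺ (All.zipWith (λ (p , l) → 𝒫-∷-near z<s (n≤1+n _) (λ _ →
        1+n≢n , l) (+1< l) (𝒫-∷-far z<s l p))
      (blocked-sound (4 + b) M 2∣4+b , blocked-> (4 + b) M)))
    where
    2∣4+b = even-+2 (even-+2 2∣b)
  blocked-sound b zero    2∣b = 𝒫-[] ∷ []
  blocked-sound b (suc M) 2∣b = free-sound (2 + b) M (even-+2 2∣b)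

  -- A view on whether the smallest admissible part is present; in either case the lower bound for
  -- the remaining parts rises by one.
  data NextPart (b : ℕ) : List ℕ → Set where
    skip : ∀ {π} → All (1 + b <_) π → NextPart b π
    take : ∀ {π} → All (1 + b <_) π → NextPart b (1 + b ∷ π)

  nextPart : ∀ {b π} → 𝒫 π → All (b <_) π → NextPart b π
  nextPart {π = []}    p _           = skip []
  nextPart {π = a ∷ π} p (b<a ∷ _) with m≤n⇒m<n∨m≡n b<a
  ... | inj₁ 1+b<a = skip (1+b<a ∷ All.map (<-trans 1+b<a) (𝒫-increasing p))
  ... | inj₂ refl  = take (𝒫-increasing p)

  InBlocks : ℕ → ℕ → List ℕ → Set
  InBlocks b M = All (_≤ b + M * 2)

  inBlocks-suc : ∀ b M {π} → InBlocks b (suc M) π → InBlocks (2 + b) M π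
  inBlocks-suc b M = All.map (λ {a} a≤ → subst (a ≤_) (trans (+-suc b _) (cong suc (+-suc b _))) a≤)

  noBlocks : ∀ {b π} → All (b <_) π → InBlocks b 0 π → π ≡ []
  noBlocks {b} []        _         = refl
  noBlocks {b} (b<a ∷ _) (a≤b ∷ _) = contradiction (subst (_ ≤_) (+-identityʳ b) a≤b) (<⇒≱ b<a)

  ∈-[[]] : ∀ {π : List ℕ} → π ≡ [] → π ∈ [ [] ]
  ∈-[[]] refl = Any.here refl

  -- The impossible cases justify the states. After 1 + b alone, 3 + b and 4 + b cannot both follow
  -- (third pattern). After 2 + b, 3 + b is an even step. If 2 + b is preceded by 1 + b, then 4 + b
  -- is excluded as well (second pattern), and if it is followed by 4 + b, then 5 + b is an even
  -- step and 6 + b completes the first pattern; both situations force an empty block.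
  free-complete : ∀ b M {π} → 2 ∣ b → 𝒫 π → All (b <_) π → InBlocks b M π → π ∈ free b M
  afterOdd-complete : ∀ b M {π} → 2 ∣ b → 𝒫 (1 + b ∷ π) → All (2 + b <_) π → InBlocks (2 + b) M π → π
      ∈ afterOdd (2 + b) M
  afterEven-complete : ∀ b M {π} → 2 ∣ b → 𝒫 (2 + b ∷ π) → InBlocks (2 + b) M π → π
      ∈ afterEven (2 + b) M
  blocked-complete : ∀ b M {π} → 2 ∣ b → 𝒫 π → All (2 + b <_) π → InBlocks b M π → π ∈ blocked b M
  free-complete b zero    2∣b p l u = ∈-[[]] (noBlocks l u)
  free-complete b (suc M) 2∣b p l u with nextPart p l
  ... | skip l₁ with nextPart p l₁
  ...   | skip l₂ = ∈-++⁺ˡ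
            (∈-++⁺ˡ (∈-++⁺ˡ (free-complete (2 + b) M (even-+2 2∣b) p l₂ (inBlocks-suc b M u))))
  ...   | take l₂ = ∈-++⁺ˡ (∈-++⁺ʳ (free (2 + b) M ++ map (1 + b ∷_) (afterOdd (2 + b) M)) (∈-map⁺ (2
            + b ∷_) (afterEven-complete b M 2∣b p (inBlocks-suc b M (All.tail u)))))
  free-complete b (suc M) 2∣b p l u | take l₁ with nextPart (𝒫-tail p) l₁
  ...   | skip l₂ = ∈-++⁺ˡ
            (∈-++⁺ˡ (∈-++⁺ʳ (free (2 + b) M) (∈-map⁺ (1
                + b ∷_) (afterOdd-complete b M 2∣b p l₂ (inBlocks-suc b M (All.tail u))))))
  ...   | take l₂ with nextPart (𝒫-tail (𝒫-tail p)) l₂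
  ...     | take l₃ = contradiction (𝒫-tail p) (¬𝒫-step (even-+2 2∣b))
  ...     | skip l₃ with nextPart (𝒫-tail (𝒫-tail p)) l₃
  ...       | take l₄ = contradiction p (¬𝒫-124 2∣b)
  ...       | skip l₄ = ∈-++⁺ʳ _
            (∈-map⁺ _ (blocked-complete (2 + b) M (even-+2 2∣b) (𝒫-tail (𝒫-tail p)) l₄
                          (inBlocks-suc b M (All.tail (All.tail u)))))
  afterOdd-complete b zero    2∣b p l u = ∈-[[]] (noBlocks l u)
  afterOdd-complete b (suc M) 2∣b p l u with nextPart (𝒫-tail p) l
  ... | skip l₁ with nextPart (𝒫-tail p) l₁
  ...   | skip l₂ = ∈-++⁺ˡ (∈-++⁺ˡ (free-complete (4 + b) M (even-+2 (even-+2 2∣b)) (𝒫-tail p) l₂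
            (inBlocks-suc (2 + b) M u)))
  ...   | take l₂ = ∈-++⁺ʳ (free (4 + b) M ++ map (3 + b ∷_) (afterOdd (4 + b) M)) (∈-map⁺ (4
            + b ∷_) (afterEven-complete (2 + b) M (even-+2 2∣b) (𝒫-tail p) (inBlocks-suc (2
                + b) M (All.tail u))))
  afterOdd-complete b (suc M) 2∣b p l u | take l₁ with nextPart (𝒫-tail (𝒫-tail p)) l₁
  ...   | skip l₂ = ∈-++⁺ˡ (∈-++⁺ʳ (free (4 + b) M) (∈-map⁺ (3 + b ∷_) (afterOdd-complete (2
            + b) M (even-+2 2∣b) (𝒫-tail p) l₂ (inBlocks-suc (2 + b) M (All.tail u)))))
  ...   | take l₂ = contradiction p (¬𝒫-134 2∣b)
  afterEven-complete b zero    2∣b p u = ∈-[[]] (noBlocks (𝒫-increasing p) u)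
  afterEven-complete b (suc M) 2∣b p u with nextPart (𝒫-tail p) (𝒫-increasing p)
  ... | take l₁ = contradiction p (¬𝒫-step (even-+2 2∣b))
  ... | skip l₁ with nextPart (𝒫-tail p) l₁
  ...   | skip l₂ = ∈-++⁺ˡ (free-complete (4 + b) M (even-+2 (even-+2 2∣b)) (𝒫-tail p) l₂
            (inBlocks-suc (2 + b) M u))
  ...   | take l₂ with nextPart (𝒫-tail (𝒫-tail p)) l₂
  ...     | take l₃ = contradiction (𝒫-tail p) (¬𝒫-step (even-+2 (even-+2 2∣b)))
  ...     | skip l₃ with nextPart (𝒫-tail (𝒫-tail p)) l₃
  ...       | take l₄ = contradiction p (¬𝒫-024 (even-+2 2∣b))
  ...       | skip l₄ = ∈-++⁺ʳ _ (∈-map⁺ _ (blocked-complete (4 + b) M (even-+2 (even-+2 2∣b))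
            (𝒫-tail (𝒫-tail p)) l₄
                          (inBlocks-suc (2 + b) M (All.tail u))))
  blocked-complete b zero    2∣b p l u = ∈-[[]] (noBlocks (+2< l) u)
  blocked-complete b (suc M) 2∣b p l u = free-complete (2 + b) M (even-+2 2∣b) p l (inBlocks-suc b M u)

-- Series in q and x

module ℤ[[q]] = PowerSeries ℤ.+-*-commutativeRing

qSeriesRing : CommutativeRing _ _
qSeriesRing = ℤ[[q]].commutativeRing

module 𝐐 = CommutativeRing qSeriesRing
open ℤ[[q]] using (_≋_; pointwise; at; _⊛_; _⊕_; ⊛-local)
open Exp 𝐐.semiring using (_^_; ^-homo-*; ^-assocʳ; ^-congˡ; ^-congʳ)

q : QSeries
q = ℤ[[q]].X

∑<-suc : ∀ n f → ∑< (suc n) f ≡ f 0 ℤ.+ ∑< n (f ∘ suc)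
∑<-suc zero    f = ℤ.+-comm 0ℤ (f 0)
∑<-suc (suc n) f = ≡.trans (≡.cong (ℤ._+ f (suc n)) (∑<-suc n f)) (ℤ.+-assoc (f 0) _ _)

*q-≋ : ∀ f g → f *q g ≋ f ⊛ g
*q-≋ f g = pointwise (go f)
  where
  go : ∀ f n → (f *q g) n ≡ (f ⊛ g) n
  go f zero    = ℤ.+-identityˡ _
  go f (suc n) = ≡.trans (∑<-suc (suc n) (λ k → f k ℤ.* g (suc n ℕ.∸ k)))
                   (≡.cong (λ u → f 0 ℤ.* g (suc n) ℤ.+ u) (go (f ∘ suc) n))

*q-cong : ∀ {f f′ g g′} → f ≋ f′ → g ≋ g′ → f *q g ≋ f′ ⊛ g′
*q-cong p p′ = 𝐐.trans (*q-≋ _ _) (𝐐.*-cong p p′)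

1q-≋ : 1q ≋ 𝐐.1#
1q-≋ .at zero    = ≡.refl
1q-≋ .at (suc n) = ≡.refl

q^-≋ : ∀ e → q^ e ≋ q ^ e
q^-≋ zero    = 1q-≋
q^-≋ (suc e) = 𝐐.trans
  (pointwise λ { zero → ≡.refl ; (suc n) → q^-≋ e .at n })
  (𝐐.sym (Dilation.X*-at ℤ.+-*-commutativeRing (q ^ e)))

^q-≋ : ∀ {f g} → f ≋ g → ∀ n → f ^q n ≋ g ^ n
^q-≋ p zero    = 1q-≋
^q-≋ p (suc n) = 𝐐.trans (*q-cong (^q-≋ p n) p) (𝐐.*-comm _ _)

^-order : ∀ {g : QSeries} → g 0 ≡ 0ℤ → ∀ r n → n ℕ.< r → (g ^ r) n ≡ 0ℤ
^-order {g} g₀ (suc r) zero    _         = ≡.cong (ℤ._* (g ^ r) 0) g₀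
^-order {g} g₀ (suc r) (suc n) (s≤s n<r) = ≡.trans
  (≡.cong₂ ℤ._+_ (≡.cong (ℤ._* (g ^ r) (suc n)) g₀)
    (≡.trans (⊛-local n (λ _ _ → ≡.refl) (λ k k≤n → ^-order g₀ r k (ℕ.≤-<-trans k≤n n<r)))
      (𝐐.zeroʳ (g ∘ suc) .at n)))
  ≡.refl

-- Up to qⁿ, `invq f` may be replaced by the sum of the first n + 1 powers of g = 1 - f; telescoping
-- leaves g^(n+1), which has no term below q^(n+1).
invq-inverseʳ : ∀ {f} → f 0 ≡ 1ℤ → f ⊛ invq f ≋ 𝐐.1#
invq-inverseʳ {f} f₀ .at n = begin
  (f ⊛ invq f) n                                  ≡⟨ ⊛-local n (λ _ _ → ≡.refl) (λ k k≤n →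
      invq-geometric k (suc n) (s≤s k≤n)) ⟩
  (f ⊛ geometric (suc n)) n                       ≡⟨ ℤ.+-identityʳ _ ⟨
  (f ⊛ geometric (suc n)) n ℤ.+ 0ℤ                ≡⟨ ≡.cong (λ u → (f ⊛ geometric (suc n)) n ℤ.+ u)
      (^-order g₀ (suc n) n ℕ.≤-refl) ⟨
  (f ⊛ geometric (suc n)) n ℤ.+ (g ^ suc n) n     ≡⟨ telescope (suc n) .at n ⟩
  𝐐.1# n                                          ∎
  where
  open ≡.≡-Reasoning
  g : QSeries
  g = 1q -q f
  g₀ : g 0 ≡ 0ℤ
  g₀ = ≡.cong (λ u → 1ℤ ℤ.- u) f₀
  geometric : ℕ → QSeries
  geometric zero    = 𝐐.0#
  geometric (suc M) = geometric M ⊕ g ^ M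
  geometric-at : ∀ M n → ∑< M (λ r → (g ^q r) n) ≡ geometric M n
  geometric-at zero    n = ≡.refl
  geometric-at (suc M) n = ≡.cong₂ ℤ._+_ (geometric-at M n) (^q-≋ 𝐐.refl M .at n)
  stable : ∀ n d → geometric (d ℕ.+ suc n) n ≡ geometric (suc n) n
  stable n zero    = ≡.refl
  stable n (suc d) = ≡.trans
    (≡.cong₂ ℤ._+_ (stable n d) (^-order g₀ (d ℕ.+ suc n) n (ℕ.m≤n+m (suc n) d)))
    (ℤ.+-identityʳ _)
  invq-geometric : ∀ k M → k ℕ.< M → invq f k ≡ geometric M k
  invq-geometric k M k<M = ≡.trans (geometric-at (suc k) k)
    (≡.sym (≡.trans (≡.cong (λ M → geometric M k) (≡.sym (ℕ.m∸n+n≡m k<M))) (stable k (M ℕ.∸ suc k))))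
  f+g : f ⊕ g ≋ 𝐐.1#
  f+g = 𝐐.trans (pointwise λ n → ≡.cong (λ u → f n ℤ.+ (u ℤ.- f n)) (1q-≋ .at n))
      (Inverses.x+[1-x]≈1 qSeriesRing f)
  telescope : ∀ M → f ⊛ geometric M ⊕ g ^ M ≋ 𝐐.1#
  telescope zero    = 𝐐.trans (𝐐.+-congʳ {x = 𝐐.1#} (𝐐.zeroʳ f)) (𝐐.+-identityˡ _)
  telescope (suc M) = Inverses.geometric-step qSeriesRing {f} {g} {geometric M} {g ^ M} f+g
      (telescope M)

-- Inverse q-Pochhammer symbols and the coefficients of A, B and D

poch-constant : ∀ {a} b n → a 0 ≡ 0ℤ → poch a b n 0 ≡ 1ℤ
poch-constant b zero    a₀ = ≡.refl
poch-constant b (suc n) a₀ = ≡.trans (ℤ.+-identityˡ _)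
  (≡.cong₂ ℤ._*_ (poch-constant b n a₀) (≡.cong (λ u → 1ℤ ℤ.- (0ℤ ℤ.+ u ℤ.* (b ^q n) 0)) a₀))

ipoch : ℕ → ℕ → QSeries
ipoch e n = invq (poch (q^ e) (q^ e) n)

ipoch-inverse : ∀ e n → poch (q^ suc e) (q^ suc e) n ⊛ ipoch (suc e) n ≋ 𝐐.1#
ipoch-inverse e n = invq-inverseʳ (poch-constant (q^ suc e) n ≡.refl)

ipoch-suc : ∀ e n → ipoch (suc e) (suc n) ≋ (q ^ suc e) ^ suc n ⊛ ipoch (suc e) (suc n)
    ⊕ ipoch (suc e) n
ipoch-suc e n = Inverses.inverse-factor qSeriesRing {p} {r} {u} {u′} (ipoch-inverse e n) p∙
  where
  u u′ r p : QSeries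
  u  = ipoch (suc e) n
  u′ = ipoch (suc e) (suc n)
  r  = (q ^ suc e) ^ suc n
  p  = poch (q^ suc e) (q^ suc e) n
  factor : 1q -q q^ suc e *q (q^ suc e) ^q n ≋ 𝐐.1# 𝐐.- r
  factor = 𝐐.+-cong 1q-≋ (𝐐.-‿cong (*q-cong (q^-≋ (suc e)) (^q-≋ (q^-≋ (suc e)) n)))
  p∙ : p ⊛ ((𝐐.1# 𝐐.- r) ⊛ u′) ≋ 𝐐.1#
  p∙ = 𝐐.trans (𝐐.sym (𝐐.*-assoc _ _ _))
         (𝐐.trans (𝐐.*-congʳ (𝐐.sym (*q-cong (𝐐.refl {p}) factor))) (ipoch-inverse e (suc n)))

module FE = FunctionalEquation qSeriesRing q
open FE using (τ; σ; σ²; Q; const; X; _^ₛ_; 𝐅; 𝐆; 𝐇; 𝐊; Recurrence)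
  renaming (commutativeRing to xqSeriesRing; _≋_ to _≋ₓ_; at to atₓ; pointwise to pointwiseₓ)

module 𝐗 = CommutativeRing xqSeriesRing

α β δ : ℕ → QSeries
α i = q ^ i ⊛ ipoch 1 i
β j = q ^ j ⊛ ipoch 4 j
δ k = sign k ⊛ q ^ (3 ℕ.* (k ℕ.* k) ℕ.+ 3 ℕ.* k) ⊛ ipoch 6 k

α-suc : ∀ j → α (suc j) ≋ q ^ suc j ⊛ α (suc j) ⊕ q ⊛ α j
α-suc j = 𝐐.trans
    (𝐐.*-congˡ (𝐐.trans (ipoch-suc 0 j) (𝐐.+-congʳ (𝐐.*-congʳ (^-congˡ (suc j) (𝐐.*-identityʳ q))))))
  (solve 4 (λ q p u v → q :* p :* (q :* p :* u :+ v) := q :* p :* (q :* p :* u) :+ q :* (p :* v))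
      𝐐.refl q (q ^ j) (ipoch 1 (suc j)) (ipoch 1 j))
  where open Solver 𝐐.commutativeSemiring using (solve; _:+_; _:*_; _:=_)

β-suc : ∀ j → β (suc j) ≋ (q ^ 4) ^ suc j ⊛ β (suc j) ⊕ q ⊛ β j
β-suc j = 𝐐.trans (𝐐.*-congˡ (ipoch-suc 3 j))
  (solve 5 (λ q p r u v → q :* p :* (r :* u :+ v) := r :* (q :* p :* u) :+ q :* (p :* v))
      𝐐.refl q (q ^ j) ((q ^ 4) ^ suc j) (ipoch 4 (suc j)) (ipoch 4 j))
  where open Solver 𝐐.commutativeSemiring using (solve; _:+_; _:*_; _:=_)

sign-suc : ∀ k → sign (suc k) ⊕ sign k ≋ 𝐐.0#
sign-suc k .at zero    = ≡.trans (≡.cong (ℤ._+ -1ℤ ℤ.^ k) (ℤ.-1*i≡-i (-1ℤ ℤ.^ k)))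
    (ℤ.+-inverseˡ (-1ℤ ℤ.^ k))
sign-suc k .at (suc n) = ≡.refl

-- From `k` to `suc k` the exponent 3k² + 3k grows by 6 (k+1), which is the factor `r`; the
-- remainder left by `ipoch-suc` then cancels against `δ k` because the signs alternate.
δ-suc : ∀ k → δ (suc k) ⊕ (q ^ 6) ^ suc k ⊛ δ k ≋ (q ^ 6) ^ suc k ⊛ δ (suc k)
δ-suc k = begin
  s′ ⊛ q ^ E (suc k) ⊛ ipoch 6 (suc k) ⊕ r ⊛ (s ⊛ q ^ E k ⊛ v)
    ≈⟨ 𝐐.+-congʳ (𝐐.*-cong (𝐐.*-congˡ {x = s′} exponent) (ipoch-suc 5 k)) ⟩
  s′ ⊛ (r ⊛ q ^ E k) ⊛ (r ⊛ u ⊕ v) ⊕ r ⊛ (s ⊛ q ^ E k ⊛ v)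
    ≈⟨ solve 6 (λ s′ s r e u v → s′ :* (r :* e) :* (r :* u :+ v) :+ r :* (s :* e :* v)
         := r :* (s′ :* (r :* e) :* u) :+ (s′ :+ s) :* (r :* e :* v)) 𝐐.refl s′ s r (q ^ E k) u v ⟩
  r ⊛ (s′ ⊛ (r ⊛ q ^ E k) ⊛ u) ⊕ (s′ ⊕ s) ⊛ (r ⊛ q ^ E k ⊛ v)
    ≈⟨ 𝐐.+-cong (𝐐.*-congˡ (𝐐.*-congʳ (𝐐.*-congˡ {x = s′} (𝐐.sym exponent))))
        (𝐐.trans (𝐐.*-congʳ (sign-suc k)) (𝐐.zeroˡ _)) ⟩
  r ⊛ δ (suc k) ⊕ 𝐐.0#
    ≈⟨ 𝐐.+-identityʳ _ ⟩
  r ⊛ δ (suc k) ∎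
  where
  open SetoidReasoning 𝐐.setoid
  open Solver 𝐐.commutativeSemiring using (solve; _:+_; _:*_; _:=_)
  E : ℕ → ℕ
  E k = 3 ℕ.* (k ℕ.* k) ℕ.+ 3 ℕ.* k
  s s′ r u v : QSeries
  s  = sign k
  s′ = sign (suc k)
  r  = (q ^ 6) ^ suc k
  u  = ipoch 6 (suc k)
  v  = ipoch 6 k
  E-suc : ∀ k → 3 ℕ.* (suc k ℕ.* suc k) ℕ.+ 3 ℕ.* suc k ≡ 6 ℕ.* suc k ℕ.+ (3 ℕ.* (k ℕ.* k) ℕ.+ 3 ℕ.* k)
  E-suc = solve-∀
  exponent : q ^ E (suc k) ≋ r ⊛ q ^ E k
  exponent = 𝐐.trans (^-congʳ q (E-suc k)) (𝐐.trans (^-homo-* q (6 ℕ.* suc k) _)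
      (𝐐.*-congʳ (𝐐.sym (^-assocʳ q 6 (suc k)))))

-- The triple sum as a product of three series

∑coeff-∑L : ∀ {I : Set} (f : I → XQSeries) L m n → ∑coeff f L m n ≡ ∑L xqSeriesRing f L m n
∑coeff-∑L f []      m n = ≡.refl
∑coeff-∑L f (i ∷ L) m n = ≡.cong (λ s → f i m n ℤ.+ s) (∑coeff-∑L f L m n)

·x^-≋ : ∀ c e m → (c ·x^ e) m ≋ (const c 𝐗.* X ^ₛ e) m
·x^-≋ c e m = 𝐐.trans (monomial e m) (𝐐.sym (FE.const⊛-at c (X ^ₛ e) m))
  where
  X^-at : ∀ e m → (X ^ₛ suc e) m ≋ FE.shift (X ^ₛ e) m
  X^-at e m = atₓ (FE.X*-at (X ^ₛ e)) m
  monomial : ∀ e m → (c ·x^ e) m ≋ c ⊛ (X ^ₛ e) m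
  monomial zero    zero    = 𝐐.sym (𝐐.*-identityʳ c)
  monomial zero    (suc m) = 𝐐.sym (𝐐.zeroʳ c)
  monomial (suc e) zero    = 𝐐.sym (𝐐.trans (𝐐.*-congˡ {x = c} (X^-at e 0)) (𝐐.zeroʳ c))
  monomial (suc e) (suc m) = 𝐐.trans (monomial e m) (𝐐.*-congˡ {x = c} (𝐐.sym (X^-at e (suc m))))

open FE.TripleProduct α β δ α-suc β-suc δ-suc using (P; A; B; D)

T : XQSeries
T = τ P

Index : Set
Index = ℕ × ℕ × ℕ

size exponent : Index → ℕ
size (i , j , k) = i ℕ.+ 2 ℕ.* j ℕ.+ 3 ℕ.* k
exponent (i , j , k) =
  let N = size (i , j , k) in
  N ℕ.* (N ℕ.∸ 1) ℕ.+ i ℕ.+ j ℕ.+ 3 ℕ.* (k ℕ.* k) ℕ.+ 3 ℕ.* k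

-- The factor q^(eN) is the substitution of xq^e for x: e = 0 gives `term`, and e = 2 gives `term′`,
-- as 2N + i + j + 3k = 3i + 5j + 9k.
coefficient : ℕ → Index → QSeries
coefficient e t@(i , j , k) = sign k *q q^ (e ℕ.* size t ℕ.+ exponent t) /q denominator i j k

invq-denominator : ∀ i j k → invq (denominator i j k) ≋ ipoch 1 i ⊛ ipoch 4 j ⊛ ipoch 6 k
invq-denominator i j k = Inverses.inverse-unique qSeriesRing {f = denominator i j k}
  (invq-inverseʳ constant)
  (𝐐.trans (𝐐.*-congʳ (𝐐.trans (*q-≋ _ p₆) (𝐐.*-congʳ (*q-≋ p₁ p₄))))
    (𝐐.trans (solve 6 (λ x y z u v w → x :* y :* z :* (u :* v :* w)
        := (x :* u) :* (y :* v) :* (z :* w)) 𝐐.refl p₁ p₄ p₆ _ _ _)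
      (𝐐.trans (𝐐.*-cong (𝐐.*-cong (ipoch-inverse 0 i) (ipoch-inverse 3 j)) (ipoch-inverse 5 k))
        (𝐐.trans (𝐐.*-identityʳ _) (𝐐.*-identityʳ _)))))
  where
  open Solver 𝐐.commutativeSemiring using (solve; _:*_; _:=_)
  p₁ p₄ p₆ : QSeries
  p₁ = poch (q^ 1) (q^ 1) i
  p₄ = poch (q^ 4) (q^ 4) j
  p₆ = poch (q^ 6) (q^ 6) k
  constant : denominator i j k 0 ≡ 1ℤ
  constant = ≡.cong₂ (λ u v → 0ℤ ℤ.+ u ℤ.* v)
    (≡.cong₂ (λ u v → 0ℤ ℤ.+ u ℤ.* v) (poch-constant (q^ 1) i ≡.refl) (poch-constant (q^ 4) j ≡.refl))
    (poch-constant (q^ 6) k ≡.refl)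

coefficient-≋ : ∀ e (t@(i , j , k) : Index) →
  coefficient e t ≋ (q ^ e) ^ size t ⊛ (q ^ (size t ℕ.* (size t ℕ.∸ 1)) ⊛ (α i ⊛ (β j ⊛ δ k)))
coefficient-≋ e t@(i , j , k) = begin
  coefficient e t
    ≈⟨ *q-cong {sign k *q q^ E} (*q-cong {sign k} 𝐐.refl (q^-≋ E)) (invq-denominator i j k) ⟩
  sign k ⊛ q ^ E ⊛ (ipoch 1 i ⊛ ipoch 4 j ⊛ ipoch 6 k)
    ≈⟨ 𝐐.*-congʳ (𝐐.*-congˡ {x = sign k} (𝐐.trans (^-congʳ q E-split) (^-homo-* q (e ℕ.* N) _))) ⟩
  sign k ⊛ (q ^ (e ℕ.* N) ⊛ q ^ (N ℕ.* (N ℕ.∸ 1) ℕ.+ (i ℕ.+ (j ℕ.+ K)))) ⊛ (ipoch 1 i ⊛ ipoch 4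
      j ⊛ ipoch 6 k)
    ≈⟨ 𝐐.*-congʳ (𝐐.*-congˡ {x = sign k} (𝐐.*-cong (𝐐.sym (^-assocʳ q e N))
         (𝐐.trans (^-homo-* q (N ℕ.* (N ℕ.∸ 1)) _) (𝐐.*-congˡ
           (𝐐.trans (^-homo-* q i _) (𝐐.*-congˡ (^-homo-* q j K))))))) ⟩
  sign k ⊛ ((q ^ e) ^ N ⊛ (q ^ (N ℕ.* (N ℕ.∸ 1)) ⊛ (q ^ i ⊛ (q ^ j ⊛ q ^ K)))) ⊛ (ipoch 1 i ⊛ ipoch 4
      j ⊛ ipoch 6 k)
    ≈⟨ solve 9 (λ s u v x y z f g h → s :* (u :* (v :* (x :* (y :* z)))) :* (f :* g :* h)
         := u :* (v :* ((x :* f) :* ((y :* g) :* (s :* z :* h))))) 𝐐.refl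
         (sign k) ((q ^ e) ^ N) (q ^ (N ℕ.* (N ℕ.∸ 1))) (q ^ i) (q ^ j) (q ^ K) (ipoch 1 i)
             (ipoch 4 j) (ipoch 6 k) ⟩
  (q ^ e) ^ N ⊛ (q ^ (N ℕ.* (N ℕ.∸ 1)) ⊛ (α i ⊛ (β j ⊛ δ k))) ∎
  where
  open SetoidReasoning 𝐐.setoid
  open Solver 𝐐.commutativeSemiring using (solve; _:*_; _:=_)
  N K E : ℕ
  N = size t
  K = 3 ℕ.* (k ℕ.* k) ℕ.+ 3 ℕ.* k
  E = e ℕ.* N ℕ.+ exponent t
  E-split : E ≡ e ℕ.* N ℕ.+ (N ℕ.* (N ℕ.∸ 1) ℕ.+ (i ℕ.+ (j ℕ.+ K)))
  E-split = lemma (e ℕ.* N) (N ℕ.* (N ℕ.∸ 1)) i j (3 ℕ.* (k ℕ.* k)) (3 ℕ.* k)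
    where
    lemma : ∀ z y i j u v → z ℕ.+ (y ℕ.+ i ℕ.+ j ℕ.+ u ℕ.+ v) ≡ z ℕ.+ (y ℕ.+ (i ℕ.+ (j ℕ.+ (u ℕ.+ v))))
    lemma = solve-∀

-- The exponent `1 ℕ.* i` gives all three factors the common shape `suc p ℕ.* j` that `∑L-partial`
-- expects.
monomial : Index → XQSeries
monomial (i , j , k) = (const (α i) 𝐗.* X ^ₛ (1 ℕ.* i))
  𝐗.* ((const (β j) 𝐗.* X ^ₛ (2 ℕ.* j)) 𝐗.* (const (δ k) 𝐗.* X ^ₛ (3 ℕ.* k)))

monomial-≋ : ∀ (t@(i , j , k) : Index) → monomial t ≋ₓ const (α i ⊛ (β j ⊛ δ k)) 𝐗.* X ^ₛ size t
monomial-≋ t@(i , j , k) = begin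
  monomial t
    ≈⟨ solve 6 (λ α β δ x y z → (α :* x) :* ((β :* y) :* (δ :* z))
        := (α :* (β :* δ)) :* (x :* y :* z)) 𝐗.refl
         (const (α i)) (const (β j)) (const (δ k)) (X ^ₛ (1 ℕ.* i)) (X ^ₛ (2 ℕ.* j)) (X ^ₛ (3 ℕ.* k)) ⟩
  const (α i) 𝐗.* (const (β j) 𝐗.* const (δ k)) 𝐗.* (X ^ₛ (1 ℕ.* i) 𝐗.* X ^ₛ (2 ℕ.* j) 𝐗.* X
      ^ₛ (3 ℕ.* k))
    ≈⟨ 𝐗.*-cong (𝐗.sym (𝐗.trans (FE.const-* (α i) _) (𝐗.*-congˡ (FE.const-* (β j) (δ k)))))
         (𝐗.sym (𝐗.trans (E.^-homo-* X (1 ℕ.* i ℕ.+ 2 ℕ.* j) _)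
             (𝐗.*-congʳ (E.^-homo-* X (1 ℕ.* i) _)))) ⟩
  const (α i ⊛ (β j ⊛ δ k)) 𝐗.* X ^ₛ (1 ℕ.* i ℕ.+ 2 ℕ.* j ℕ.+ 3 ℕ.* k)
    ≈⟨ 𝐗.*-congˡ (𝐗.reflexive (≡.cong (λ i → X ^ₛ (i ℕ.+ 2 ℕ.* j ℕ.+ 3 ℕ.* k)) (ℕ.*-identityˡ i))) ⟩
  const (α i ⊛ (β j ⊛ δ k)) 𝐗.* X ^ₛ size t ∎
  where
  module E = Exp 𝐗.semiring
  open SetoidReasoning 𝐗.setoid
  open Solver 𝐗.commutativeSemiring using (solve; _:*_; _:=_)

-- The only nonzero coefficient is at m = N. In this way factors depending on the index N turn into
-- the operators `σ` and `τ`, which depend on the degree m.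
·x^-cong : ∀ (g : ℕ → QSeries) c c′ N m → c ≋ g N ⊛ c′ → (c ·x^ N) m ≋ g m ⊛ (c′ ·x^ N) m
·x^-cong g c c′ N m eq with m ℕ.≡ᵇ N | ℕ.≡ᵇ⇒≡ m N
... | false | _   = 𝐐.sym (𝐐.zeroʳ (g m))
... | true  | m≡N with ≡.refl ← m≡N _ = eq

generalTerm : ℕ → Index → XQSeries
generalTerm e t = coefficient e t ·x^ size t

generalTerm-≋ : ∀ e t → generalTerm e t ≋ₓ σ (q ^ e) (τ (monomial t))
generalTerm-≋ e t@(i , j , k) = pointwiseₓ λ m → 𝐐.trans
  (·x^-cong ((q ^ e) ^_) (coefficient e t) _ (size t) m (coefficient-≋ e t))
  (𝐐.*-congˡ {x = (q ^ e) ^ m} (𝐐.trans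
    (·x^-cong (λ m → q ^ (m ℕ.* (m ℕ.∸ 1))) _ (α i ⊛ (β j ⊛ δ k)) (size t) m 𝐐.refl)
    (𝐐.*-congˡ {x = q ^ (m ℕ.* (m ℕ.∸ 1))} (𝐐.trans (·x^-≋ (α i ⊛ (β j ⊛ δ k)) (size t) m)
        (𝐐.sym (atₓ (monomial-≋ t) m))))))

-- A box, rather than the set of triples with N at most m, because the sum over a box factors into
-- three one-dimensional sums.
box : ℕ → List Index
box M = cartesianProduct (upTo M) (cartesianProduct (upTo M) (upTo M))

∑L-στ : ∀ {I : Set} r (f : I → XQSeries) L →
  ∑L xqSeriesRing (λ t → σ r (τ (f t))) L ≋ₓ σ r (τ (∑L xqSeriesRing f L))
∑L-στ r f []      = pointwiseₓ λ m → 𝐐.sym (𝐐.trans (𝐐.*-congˡ (𝐐.zeroʳ _)) (𝐐.zeroʳ _))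
∑L-στ r f (t ∷ L) = 𝐗.trans (𝐗.+-congˡ {x = σ r (τ (f t))} (∑L-στ r f L))
  (𝐗.sym (𝐗.trans (FE.σ-cong (FE.τ-+ (f t) _)) (FE.σ-+ r (τ (f t)) _)))

box-product : ∀ M → ∑L xqSeriesRing monomial (box M)
  ≋ₓ FE.partial 0 α M 𝐗.* (FE.partial 1 β M 𝐗.* FE.partial 2 δ M)
box-product M = 𝐗.trans (∑L-cartesianProduct xqSeriesRing u vw (upTo M) _)
  (𝐗.*-cong (axis 0 α) (𝐗.trans (∑L-cartesianProduct xqSeriesRing v w (upTo M) _)
    (𝐗.*-cong (axis 1 β) (axis 2 δ))))
  where
  u v w : ℕ → XQSeries
  u i = const (α i) 𝐗.* X ^ₛ (1 ℕ.* i)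
  v j = const (β j) 𝐗.* X ^ₛ (2 ℕ.* j)
  w k = const (δ k) 𝐗.* X ^ₛ (3 ℕ.* k)
  vw : ℕ × ℕ → XQSeries
  vw (j , k) = v j 𝐗.* w k
  axis : ∀ p c → ∑L xqSeriesRing (λ j → const (c j) 𝐗.* X ^ₛ (suc p ℕ.* j)) (upTo M) ≋ₓ FE.partial p c M
  axis p c = 𝐗.trans (FE.∑L-partial p c M 𝐗.1# _ _ (λ j → 𝐗.sym (𝐗.*-identityˡ _))) (𝐗.*-identityˡ _)

∑coeff-box : ∀ e m n → ∑coeff (generalTerm e) (box (suc m)) m n ≡ σ (q ^ e) T m n
∑coeff-box e m n = ≡.trans (∑coeff-∑L (generalTerm e) (box (suc m)) m n) (total .at n)
  where
  M : ℕ
  M = suc m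
  factors : (FE.partial 0 α M 𝐗.* (FE.partial 1 β M 𝐗.* FE.partial 2 δ M)) m ≋ P m
  factors = 𝐐.trans
    (FE.⊛-local m (λ k k≤m → FE.partial-strided 0 α M k (s≤s k≤m))
      (λ k k≤m → FE.⊛-local k (λ l l≤k → FE.partial-strided 1 β M l (s≤s (ℕ.≤-trans l≤k k≤m)))
                               (λ l l≤k → FE.partial-strided 2 δ M l (s≤s (ℕ.≤-trans l≤k k≤m)))))
    (𝐐.sym (atₓ (𝐗.*-assoc A B D) m))
  total : ∑L xqSeriesRing (generalTerm e) (box M) m ≋ σ (q ^ e) T m
  total = 𝐐.trans (atₓ (𝐗.trans (∑L-cong xqSeriesRing (generalTerm-≋ e) (box M))
      (∑L-στ (q ^ e) monomial (box M))) m)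
    (𝐐.*-congˡ {x = (q ^ e) ^ m} (𝐐.*-congˡ {x = q ^ (m ℕ.* (m ℕ.∸ 1))}
      (𝐐.trans (atₓ (box-product M) m) factors)))

hasSum-generalTerm : ∀ e → HasSum U (generalTerm e) (σ (q ^ e) T)
hasSum-generalTerm e = hasSum λ m n → box (suc m)
  , Unique.cartesianProduct⁺ (Unique.upTo⁺ (suc m)) (Unique.cartesianProduct⁺ (Unique.upTo⁺ (suc m))
      (Unique.upTo⁺ (suc m)))
  , All.universal (λ _ → _) _
  , (λ {t} _ → inBox t m n)
  , ∑coeff-box e m n
  where
  inBox : ∀ t m n → t ∈ box (suc m) ⊎ generalTerm e t m n ≡ 0ℤ
  inBox t@(i , j , k) m n with m ℕ.≡ᵇ size t | ℕ.≡ᵇ⇒≡ m (size t)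
  ... | false | _   = inj₂ ≡.refl
  ... | true  | m≡N with ≡.refl ← m≡N _ = inj₁ (∈-cartesianProduct⁺ (∈-upTo⁺ (s≤s i≤))
          (∈-cartesianProduct⁺ (∈-upTo⁺ (s≤s j≤)) (∈-upTo⁺ (s≤s k≤))))
    where
    i≤ : i ℕ.≤ size t
    i≤ = ℕ.≤-trans (ℕ.m≤m+n i _) (ℕ.m≤m+n _ _)
    j≤ : j ℕ.≤ size t
    j≤ = ℕ.≤-trans (ℕ.m≤n*m j 2) (ℕ.≤-trans (ℕ.m≤n+m _ i) (ℕ.m≤m+n _ _))
    k≤ : k ℕ.≤ size t
    k≤ = ℕ.≤-trans (ℕ.m≤n*m k 3) (ℕ.m≤n+m _ (i ℕ.+ 2 ℕ.* j))

HasSum-cong : ∀ {I : Set} {P : I → Set} {f g : I → XQSeries} {S} → (∀ i m n → f i m n ≡ g i m n) →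
    HasSum P f S → HasSum P g S
HasSum-cong {I} {f = f} {g} eq h m n with L , uL , allL , s ← h m n =
  L , uL , allL , λ L′ uL′ allL′ sub → ≡.trans (≡.sym (go L′)) (s L′ uL′ allL′ sub)
  where
  go : ∀ (L : List I) → ∑coeff f L m n ≡ ∑coeff g L m n
  go []      = ≡.refl
  go (i ∷ L) = ≡.cong₂ ℤ._+_ (eq i m n) (go L)

hasSum-term : HasSum U term (σ (q ^ 0) T)
hasSum-term = hasSum-generalTerm 0

hasSum-term′ : HasSum U term′ (σ (q ^ 2) T)
hasSum-term′ = HasSum-cong eq (hasSum-generalTerm 2)
  where
  lemma : ∀ y i j u k → 2 ℕ.* (i ℕ.+ 2 ℕ.* j ℕ.+ 3 ℕ.* k) ℕ.+ (y ℕ.+ i ℕ.+ j ℕ.+ u ℕ.+ 3 ℕ.* k)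
    ≡ y ℕ.+ 3 ℕ.* i ℕ.+ 5 ℕ.* j ℕ.+ u ℕ.+ 9 ℕ.* k
  lemma = solve-∀
  eq : ∀ t m n → generalTerm 2 t m n ≡ term′ t m n
  eq t@(i , j , k) m n = ≡.cong (λ E → ((sign k *q q^ E /q denominator i j k) ·x^ size t) m n)
    (lemma (size t ℕ.* (size t ℕ.∸ 1)) i j (3 ℕ.* (k ℕ.* k)) k)

-- Generating functions of the block lists

open Partitions

∑w : List (List ℕ) → XQSeries
∑w = ∑L xqSeriesRing weight

weight-≋ : ∀ π → weight π ≋ₓ const (q ^ sum π) 𝐗.* X ^ₛ length π
weight-≋ π = pointwiseₓ λ m → 𝐐.trans (·x^-≋ (q^ sum π) (length π) m)
  (atₓ (𝐗.*-congʳ (FE.const-cong (q^-≋ (sum π)))) m)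

weight-∷ : ∀ a π → weight (a ∷ π) ≋ₓ const (q ^ a) 𝐗.* (X 𝐗.* weight π)
weight-∷ a π = begin
  weight (a ∷ π)
    ≈⟨ weight-≋ (a ∷ π) ⟩
  const (q ^ (a ℕ.+ sum π)) 𝐗.* (X 𝐗.* X ^ₛ length π)
    ≈⟨ 𝐗.*-congʳ (𝐗.trans (FE.const-cong (^-homo-* q a (sum π))) (FE.const-* (q ^ a) (q ^ sum π))) ⟩
  const (q ^ a) 𝐗.* const (q ^ sum π) 𝐗.* (X 𝐗.* X ^ₛ length π)
    ≈⟨ solve 4 (λ a s x y → a :* s :* (x :* y) := a :* (x :* (s :* y)))
        𝐗.refl (const (q ^ a)) (const (q ^ sum π)) X (X ^ₛ length π) ⟩
  const (q ^ a) 𝐗.* (X 𝐗.* (const (q ^ sum π) 𝐗.* X ^ₛ length π))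
    ≈⟨ 𝐗.*-congˡ (𝐗.*-congˡ (weight-≋ π)) ⟨
  const (q ^ a) 𝐗.* (X 𝐗.* weight π) ∎
  where
  open SetoidReasoning 𝐗.setoid
  open Solver 𝐗.commutativeSemiring using (solve; _:*_; _:=_)

∑w-∷ : ∀ a L {f} → ∑w L ≋ₓ f → ∑w (map (a ∷_) L) ≋ₓ const (q ^ a) 𝐗.* (X 𝐗.* f)
∑w-∷ a L {f} eq = begin
  ∑w (map (a ∷_) L)                    ≈⟨ ∑L-map xqSeriesRing weight (a ∷_) L ⟩
  ∑L xqSeriesRing (weight ∘ (a ∷_)) L  ≈⟨ ∑L-cong xqSeriesRing (weight-∷ a) L ⟩
  ∑L xqSeriesRing (λ π → const (q ^ a) 𝐗.* (X 𝐗.* weight π)) L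
    ≈⟨ ∑L-*ˡ xqSeriesRing (const (q ^ a)) _ L ⟩
  const (q ^ a) 𝐗.* ∑L xqSeriesRing (λ π → X 𝐗.* weight π) L
    ≈⟨ 𝐗.*-congˡ (∑L-*ˡ xqSeriesRing X weight L) ⟩
  const (q ^ a) 𝐗.* (X 𝐗.* ∑w L)
    ≈⟨ 𝐗.*-congˡ (𝐗.*-congˡ eq) ⟩
  const (q ^ a) 𝐗.* (X 𝐗.* f) ∎
  where open SetoidReasoning 𝐗.setoid

∑w-++ : ∀ L L′ {f g} → ∑w L ≋ₓ f → ∑w L′ ≋ₓ g → ∑w (L ++ L′) ≋ₓ f 𝐗.+ g
∑w-++ L L′ p p′ = 𝐗.trans (∑L-++ xqSeriesRing weight L L′) (𝐗.+-cong p p′)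

∑w-[[]] : ∀ b → ∑w [ [] ] ≋ₓ σ (q ^ b) 𝐗.1#
∑w-[[]] b = 𝐗.trans (𝐗.+-identityʳ (weight []))
    (𝐗.trans (weight-≋ []) (𝐗.trans (𝐗.*-identityʳ _) (𝐗.sym (FE.σ-const _ _))))

-- Raising every part by `b` multiplies the weight of π by q^(b ℓ(π)), so the four series are needed
-- for b = 0 only and `b` enters through the dilation alone.
∑w-free : ∀ b M → ∑w (free b M) ≋ₓ σ (q ^ b) (𝐅 M)
∑w-afterOdd : ∀ b M → ∑w (afterOdd b M) ≋ₓ σ (q ^ b) (𝐆 M)
∑w-afterEven : ∀ b M → ∑w (afterEven b M) ≋ₓ σ (q ^ b) (𝐇 M)
∑w-blocked : ∀ b M → ∑w (blocked b M) ≋ₓ σ (q ^ b) (𝐊 M)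
∑w-free b zero    = ∑w-[[]] b
∑w-free b (suc M) = 𝐗.trans
  (∑w-++ (afterOdd b (suc M)) _ (∑w-afterOdd b (suc M))
    (𝐗.trans (𝐗.sym (∑w-map-∘ (blocked (2 ℕ.+ b) M)))
      (∑w-∷ (1 ℕ.+ b) (map (2 ℕ.+ b ∷_) (blocked (2 ℕ.+ b) M)) (∑w-∷ (2 ℕ.+ b) (blocked (2 ℕ.+ b) M)
          (∑w-blocked (2 ℕ.+ b) M)))))
  (𝐗.sym (𝐗.trans (FE.σ-+ (q ^ b) (𝐆 (suc M)) _) (𝐗.+-congˡ {x = σ (q ^ b) (𝐆 (suc M))}
      (FE.σ-Q³X²* b (𝐊 M)))))
  where
  ∑w-map-∘ : ∀ L → ∑w (map (1 ℕ.+ b ∷_) (map (2 ℕ.+ b ∷_) L))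
      ≋ₓ ∑w (map (λ π → 1 ℕ.+ b ∷ 2 ℕ.+ b ∷ π) L)
  ∑w-map-∘ []      = 𝐗.refl
  ∑w-map-∘ (π ∷ L) = 𝐗.+-congˡ {x = weight (1 ℕ.+ b ∷ 2 ℕ.+ b ∷ π)} (∑w-map-∘ L)
∑w-afterOdd b zero    = ∑w-[[]] b
∑w-afterOdd b (suc M) = 𝐗.trans
  (∑w-++ (free (2 ℕ.+ b) M ++ map (1 ℕ.+ b ∷_) (afterOdd (2 ℕ.+ b) M)) _
    (∑w-++ (free (2 ℕ.+ b) M) _ (∑w-free (2 ℕ.+ b) M) (∑w-∷ (1 ℕ.+ b) (afterOdd (2 ℕ.+ b) M)
        (∑w-afterOdd (2 ℕ.+ b) M)))
    (∑w-∷ (2 ℕ.+ b) (afterEven (2 ℕ.+ b) M) (∑w-afterEven (2 ℕ.+ b) M)))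
  (𝐗.sym (𝐗.trans (FE.σ-+ (q ^ b) (σ² (𝐅 M) 𝐗.+ Q 𝐗.* (X 𝐗.* σ² (𝐆 M))) _)
    (𝐗.+-cong (𝐗.trans (FE.σ-+ (q ^ b) (σ² (𝐅 M)) _) (𝐗.+-cong (FE.σ-σ² b (𝐅 M)) (FE.σ-QX* b (𝐆 M))))
        (FE.σ-Q²X* b (𝐇 M)))))
∑w-afterEven b zero    = ∑w-[[]] b
∑w-afterEven b (suc M) = 𝐗.trans
  (∑w-++ (free (2 ℕ.+ b) M) _ (∑w-free (2 ℕ.+ b) M) (∑w-∷ (2 ℕ.+ b) (blocked (2 ℕ.+ b) M)
      (∑w-blocked (2 ℕ.+ b) M)))
  (𝐗.sym (𝐗.trans (FE.σ-+ (q ^ b) (σ² (𝐅 M)) _) (𝐗.+-cong (FE.σ-σ² b (𝐅 M)) (FE.σ-Q²X* b (𝐊 M)))))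
∑w-blocked b zero    = ∑w-[[]] b
∑w-blocked b (suc M) = 𝐗.trans (∑w-free (2 ℕ.+ b) M) (𝐗.sym (FE.σ-σ² b (𝐅 M)))

-- Congruences modulo powers of q and uniqueness

infix 4 _≈_mod-q^_
_≈_mod-q^_ : XQSeries → XQSeries → ℕ → Set
f ≈ g mod-q^ k = ∀ m n → n ℕ.< k → f m n ≡ g m n

weaken : ∀ {f g k l} → l ℕ.≤ k → f ≈ g mod-q^ k → f ≈ g mod-q^ l
weaken l≤k p m n n<l = p m n (ℕ.<-≤-trans n<l l≤k)

mod-+ : ∀ {k} f f′ g g′ → f ≈ f′ mod-q^ k → g ≈ g′ mod-q^ k → f 𝐗.+ g ≈ f′ 𝐗.+ g′ mod-q^ k
mod-+ f f′ g g′ p p′ m n n<k = ≡.cong₂ ℤ._+_ (p m n n<k) (p′ m n n<k)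

⊛-mod : ∀ {k} (h f g : QSeries) → (∀ n → n ℕ.< k → f n ≡ g n) → ∀ n → n ℕ.< k → (h ⊛ f) n ≡ (h ⊛ g) n
⊛-mod h f g p n n<k = ⊛-local n (λ _ _ → ≡.refl) (λ l l≤n → p l (ℕ.≤-<-trans l≤n n<k))

mod-σ² : ∀ {k} f g → f ≈ g mod-q^ k → σ² f ≈ σ² g mod-q^ k
mod-σ² f g p m = ⊛-mod ((q ^ 2) ^ m) (f m) (g m) (p m)

mod-X* : ∀ {k} f g → f ≈ g mod-q^ k → X 𝐗.* f ≈ X 𝐗.* g mod-q^ k
mod-X* f g p zero    n n<k = ≡.trans (atₓ (FE.X*-at f) 0 .at n) (≡.sym (atₓ (FE.X*-at g) 0 .at n))
mod-X* f g p (suc m) n n<k = ≡.trans (atₓ (FE.X*-at f) (suc m) .at n)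
  (≡.trans (p m n n<k) (≡.sym (atₓ (FE.X*-at g) (suc m) .at n)))

mod-Q^* : ∀ e {k} f g → f ≈ g mod-q^ k → Q ^ₛ e 𝐗.* f ≈ Q ^ₛ e 𝐗.* g mod-q^ (e ℕ.+ k)
mod-Q^* e f g p m n n<k = ≡.trans (Q^*-at f)
  (≡.trans (Dilation.X^*-local ℤ.+-*-commutativeRing e (p m) n n<k) (≡.sym (Q^*-at g)))
  where
  Q^*-at : ∀ f → (Q ^ₛ e 𝐗.* f) m n ≡ (q ^ e ⊛ f m) n
  Q^*-at f = atₓ (𝐗.trans (𝐗.*-congʳ (𝐗.sym (FE.const-^ q e)))
      (pointwiseₓ (FE.const⊛-at (q ^ e) f))) m .at n

-- For m ≥ 1 the coefficient of x^m is multiplied by q^(2m), which gains at least one power of q.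
-- The coefficient of x^0 gains none and has to agree beforehand.
mod-σ²-gain : ∀ {k} f g → f 0 ≋ g 0 → f ≈ g mod-q^ k → σ² f ≈ σ² g mod-q^ suc k
mod-σ²-gain f g p₀ p zero    n _   = 𝐐.*-congˡ {x = 𝐐.1#} p₀ .at n
mod-σ²-gain {k} f g p₀ p (suc m) n n<1+k = ≡.trans (^-assoc-at f)
  (≡.trans (Dilation.X^*-local ℤ.+-*-commutativeRing (2 ℕ.* suc m) (p (suc m)) n
             (ℕ.<-≤-trans n<1+k (ℕ.+-monoˡ-≤ k (s≤s (z≤n {n = m ℕ.+ suc (m ℕ.+ 0)})))))
    (≡.sym (^-assoc-at g)))
  where
  ^-assoc-at : ∀ f → σ² f (suc m) n ≡ (q ^ (2 ℕ.* suc m) ⊛ f (suc m)) n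
  ^-assoc-at f = 𝐐.*-congʳ {x = f (suc m)} (^-assocʳ q 2 (suc m)) .at n

-- Every term but f₂(xq²) carries a power of q that outweighs its lower precision; for f₂(xq²) the
-- power comes from the dilation, by `mod-σ²-gain`.
recurrence-mod : ∀ {k f₃ f₂ f₁ f₀ g₃ g₂ g₁ g₀} → Recurrence f₃ f₂ f₁ f₀ → Recurrence g₃ g₂ g₁ g₀ →
  f₂ 0 ≋ g₂ 0 → f₂ ≈ g₂ mod-q^ k → f₁ ≈ g₁ mod-q^ (k ℕ.∸ 1) → f₀ ≈ g₀ mod-q^ (k ℕ.∸ 2) →
  f₃ ≈ g₃ mod-q^ suc k
recurrence-mod {k} {f₃} {f₂} {f₁} {f₀} {g₃} {g₂} {g₁} {g₀} rf rg f₂₀ p₂ p₁ p₀ m n n<1+k =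
  GroupProperties.∙-cancelʳ (CommutativeRing.+-group ℤ.+-*-commutativeRing)
      ((Q ^ₛ 8 𝐗.* (X 𝐗.* XXσσσ f₀)) m n) (f₃ m n) (g₃ m n)
    (≡.trans (atₓ rf m .at n) (≡.trans (rhs m n n<1+k) (≡.trans (≡.sym (atₓ rg m .at n))
      (≡.cong (λ u → g₃ m n ℤ.+ u) (≡.sym (lhs m n n<1+k))))))
  where
  XXσσσ : XQSeries → XQSeries
  XXσσσ f = X 𝐗.* (X 𝐗.* σ² (σ² (σ² f)))
  cube : XXσσσ f₀ ≈ XXσσσ g₀ mod-q^ (k ℕ.∸ 2)
  cube = mod-X* _ _ (mod-X* _ _ (mod-σ² _ _ (mod-σ² _ _ (mod-σ² f₀ g₀ p₀))))
  square : σ² (σ² f₁) ≈ σ² (σ² g₁) mod-q^ (k ℕ.∸ 1)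
  square = mod-σ² _ _ (mod-σ² f₁ g₁ p₁)
  -- `e` is the loss of precision and 1 + e + d the exponent of q in front: 2 = 1+1+0 and 3 = 1+1+1
  -- for f₁, 6 = 1+2+3 and 8 = 1+2+5 for f₀.
  1+k≤ : ∀ e d → suc k ℕ.≤ suc e ℕ.+ d ℕ.+ (k ℕ.∸ e)
  1+k≤ e d = s≤s (ℕ.≤-trans (ℕ.m≤n+m∸n k e) (ℕ.+-monoˡ-≤ (k ℕ.∸ e) (ℕ.m≤m+n e d)))
  lhs : Q ^ₛ 8 𝐗.* (X 𝐗.* XXσσσ f₀) ≈ Q ^ₛ 8 𝐗.* (X 𝐗.* XXσσσ g₀) mod-q^ suc k
  lhs = weaken {Q ^ₛ 8 𝐗.* (X 𝐗.* XXσσσ f₀)} {Q ^ₛ 8 𝐗.* (X 𝐗.* XXσσσ g₀)} (1+k≤ 2 5)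
      (mod-Q^* 8 _ _ (mod-X* _ _ cube))
  Q¹ : Q 𝐗.* (X 𝐗.* σ² f₂) ≈ Q 𝐗.* (X 𝐗.* σ² g₂) mod-q^ suc k
  Q¹ m n n<1+k = ≡.trans (identity f₂) (≡.trans (mod-Q^* 1 _ _ (mod-X* _ _ (mod-σ² f₂ g₂ p₂)) m n
      n<1+k) (≡.sym (identity g₂)))
    where
    identity : ∀ f → (Q 𝐗.* (X 𝐗.* σ² f)) m n ≡ (Q ^ₛ 1 𝐗.* (X 𝐗.* σ² f)) m n
    identity f = atₓ (𝐗.*-congʳ {x = X 𝐗.* σ² f} (𝐗.sym (𝐗.*-identityʳ Q))) m .at n
  rhs : σ² f₂ 𝐗.+ Q 𝐗.* (X 𝐗.* σ² f₂) 𝐗.+ Q ^ₛ 2 𝐗.* (X 𝐗.* σ² (σ² f₁))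
          𝐗.+ Q ^ₛ 3 𝐗.* (X 𝐗.* (X 𝐗.* σ² (σ² f₁))) 𝐗.+ Q ^ₛ 6 𝐗.* XXσσσ f₀
        ≈ σ² g₂ 𝐗.+ Q 𝐗.* (X 𝐗.* σ² g₂) 𝐗.+ Q ^ₛ 2 𝐗.* (X 𝐗.* σ² (σ² g₁))
          𝐗.+ Q ^ₛ 3 𝐗.* (X 𝐗.* (X 𝐗.* σ² (σ² g₁))) 𝐗.+ Q ^ₛ 6 𝐗.* XXσσσ g₀ mod-q^ suc k
  rhs = mod-+ _ _ (Q ^ₛ 6 𝐗.* XXσσσ f₀) (Q ^ₛ 6 𝐗.* XXσσσ g₀)
    (mod-+ _ _ (Q ^ₛ 3 𝐗.* (X 𝐗.* (X 𝐗.* σ² (σ² f₁)))) (Q ^ₛ 3 𝐗.* (X 𝐗.* (X 𝐗.* σ² (σ² g₁))))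
      (mod-+ _ _ (Q ^ₛ 2 𝐗.* (X 𝐗.* σ² (σ² f₁))) (Q ^ₛ 2 𝐗.* (X 𝐗.* σ² (σ² g₁)))
        (mod-+ (σ² f₂) (σ² g₂) (Q 𝐗.* (X 𝐗.* σ² f₂)) (Q 𝐗.* (X 𝐗.* σ² g₂))
            (mod-σ²-gain f₂ g₂ f₂₀ p₂) Q¹)
        (weaken {Q ^ₛ 2 𝐗.* (X 𝐗.* σ² (σ² f₁))} {Q ^ₛ 2 𝐗.* (X 𝐗.* σ² (σ² g₁))} (1+k≤ 1 0)
            (mod-Q^* 2 _ _ (mod-X* _ _ square))))
      (weaken {Q ^ₛ 3 𝐗.* (X 𝐗.* (X 𝐗.* σ² (σ² f₁)))} {Q ^ₛ 3 𝐗.* (X 𝐗.* (X 𝐗.* σ² (σ² g₁)))}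
          (1+k≤ 1 1) (mod-Q^* 3 _ _ (mod-X* _ _ (mod-X* _ _ square)))))
    (weaken {Q ^ₛ 6 𝐗.* XXσσσ f₀} {Q ^ₛ 6 𝐗.* XXσσσ g₀} (1+k≤ 2 3) (mod-Q^* 6 _ _ cube))

ipoch-zero : ∀ e → ipoch (suc e) 0 ≋ 𝐐.1#
ipoch-zero e = 𝐐.trans (𝐐.sym (𝐐.*-identityˡ (ipoch (suc e) 0)))
  (𝐐.trans (𝐐.*-congʳ {x = ipoch (suc e) 0} (𝐐.sym 1q-≋)) (ipoch-inverse e 0))

T-at-0 : T 0 ≋ 𝐐.1#
T-at-0 = begin
  𝐐.1# ⊛ (α 0 ⊛ β 0 ⊛ δ 0)                ≈⟨ 𝐐.*-identityˡ _ ⟩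
  α 0 ⊛ β 0 ⊛ δ 0
      ≈⟨ 𝐐.*-cong (𝐐.*-cong (unit (ipoch-zero 0)) (unit (ipoch-zero 3)))
                                                (𝐐.*-cong sign-zero (ipoch-zero 5)) ⟩
  𝐐.1# ⊛ 𝐐.1# ⊛ (𝐐.1# ⊛ 𝐐.1#)             ≈⟨ 𝐐.*-cong (𝐐.*-identityˡ _) (𝐐.*-identityˡ _) ⟩
  𝐐.1# ⊛ 𝐐.1#                             ≈⟨ 𝐐.*-identityˡ _ ⟩
  𝐐.1#                                    ∎
  where
  open SetoidReasoning 𝐐.setoid
  unit : ∀ {f} → f ≋ 𝐐.1# → 𝐐.1# ⊛ f ≋ 𝐐.1#
  unit p = 𝐐.trans (𝐐.*-identityˡ _) p
  sign-zero : sign 0 ⊛ 𝐐.1# ≋ 𝐐.1#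
  sign-zero = 𝐐.trans (𝐐.*-identityʳ (sign 0)) 1q-≋

-- Three consecutive truncations are carried along because the recurrence reaches three steps back.
-- For M = 0 all three claims are modulo q^0 and hence empty.
𝐅-T : ∀ M → (𝐅 (2 ℕ.+ M) ≈ T mod-q^ M) × (𝐅 (1 ℕ.+ M) ≈ T mod-q^ (M ℕ.∸ 1)) × (𝐅 M ≈ T mod-q^ (M ℕ.∸ 2))
𝐅-T zero    = (λ m n ()) , (λ m n ()) , (λ m n ())
𝐅-T (suc M) with p₂ , p₁ , p₀ ← 𝐅-T M =
    recurrence-mod {f₂ = 𝐅 (2 ℕ.+ M)} {g₂ = T} (FE.𝐅-recurrence M) T-recurrence
      (𝐐.trans (FE.𝐅-at-0 (2 ℕ.+ M)) (𝐐.sym T-at-0)) p₂ p₁ p₀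
  , p₂ , p₁
  where
  T-recurrence : Recurrence T T T T
  T-recurrence = FE.TripleProduct.recurrence α β δ α-suc β-suc δ-suc

-- The two identities

parts≤sum : ∀ π → All (ℕ._≤ sum π) π
parts≤sum []      = []
parts≤sum (a ∷ π) = ℕ.m≤m+n a _ ∷ All.map (λ b≤ → ℕ.≤-trans b≤ (ℕ.m≤n+m _ a)) (parts≤sum π)

hasSum-weight : ∀ e {P : List ℕ → Set} → 2 ∣ e → (∀ {π} → P π → 𝒫 π × All (e ℕ.<_) π) →
  (∀ {π} → 𝒫 π → All (e ℕ.<_) π → P π) → HasSum P weight (σ (q ^ e) T)
-- With 3 + n blocks, `𝐅-T (suc n)` gives agreement modulo q^(n+1), which covers the coefficient of
-- qⁿ; these blocks also reach beyond every part of a partition of n.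
hasSum-weight e {P} 2∣e to from = hasSum λ m n → let M = 3 ℕ.+ n in
    free e M
  , free-unique e M
  , All.zipWith (λ (p , l) → from p l) (free-sound e M 2∣e , free-> e M)
  , (λ {π} p → listed m n π p)
  , ≡.trans (∑coeff-∑L weight (free e M) m n)
      (≡.trans (atₓ (∑w-free e M) m .at n)
        (⊛-mod ((q ^ e) ^ m) (𝐅 M m) (T m) (proj₁ (𝐅-T (suc n)) m) n ℕ.≤-refl))
  where
  listed : ∀ m n π → P π → π ∈ free e (3 ℕ.+ n) ⊎ weight π m n ≡ 0ℤ
  listed m n π p with m ℕ.≡ᵇ length π
  ... | false = inj₂ ≡.refl
  ... | true with n ℕ.≡ᵇ sum π | ℕ.≡ᵇ⇒≡ n (sum π)
  ...   | false | _   = inj₂ ≡.refl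
  ...   | true  | n≡s with ≡.refl ← n≡s _ = inj₁ (free-complete e (3 ℕ.+ sum π) 2∣e (proj₁ (to p)) (proj₂ (to p))
            (All.map (λ {a} a≤n → ℕ.≤-trans a≤n bound) (parts≤sum π)))
    where
    bound : sum π ℕ.≤ e ℕ.+ (3 ℕ.+ sum π) ℕ.* 2
    bound = ℕ.≤-trans (ℕ.m≤n+m (sum π) 3) (ℕ.≤-trans (ℕ.m≤m*n (3 ℕ.+ sum π) 2) (ℕ.m≤n+m _ e))

mainTheorem5 : (∃ λ (S : XQSeries) → HasSum 𝒫 weight S × HasSum U term S)
    × (∃ λ (S : XQSeries) → HasSum 𝒫′ weight S × HasSum U term′ S)
mainTheorem5 =
    (σ (q ^ 0) T , hasSum-weight 0 (2 ∣0) (λ p → p , proj₁ (𝒫.isPartition p)) (λ p _ → p) , hasSum-term)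
  , (σ (q ^ 2) T , hasSum-weight 2 ∣-refl (λ p → p) _,_ , hasSum-term′)
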